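{- For every integer $n\geq0$, \[ (q;q)_{2n}\,CP_{(3,1)}(n) = \sum_{r= -\infty}^\infty (-1)^r q^{r(3r+1)} {2 n\brack n-3r+\frac{(-1)^r-1}{2}}_q. \]
   Context: $(a;q)_m=\prod_{j=0}^{m-1}(1-aq^j)$; for integers $a,b$, ${a\brack b}_q=\frac{(q;q)_a}{(q;q)_b(q;q)_{a-b}}$ if $0\le b\le a$ and $0$ otherwise. A cylindric partition with profile $(c_1,c_2)$ is a pair of partitions $(\lambda^{(1)},\lambda^{(2)})$ (parts weakly decreasing, $\lambda^{(i)}_j=0$ beyond the number of parts) with $\lambda^{(1)}_j\ge\lambda^{(2)}_{j+c_2}$ and $\lambda^{(2)}_j\ge\lambda^{(1)}_{j+c_1}$ for all $j\ge1$; its size is $|\lambda^{(1)}|+|\lambda^{(2)}|$. $CP_{(3,1)}(n)$ is the generating function $\sum q^{\text{size}}$ over cylindric partitions of profile $(3,1)$ in which each partition has at most $n$ parts, with $CP_{(3,1)}(0)=1$. -}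

module Defs where

open import Data.Bool using (Bool; true; false; if_then_else_; _∧_)
open import Data.Nat as ℕ using (ℕ; zero; suc; _∸_; _≤ᵇ_; _≡ᵇ_; _%_)
open import Data.Integer as ℤ using (ℤ; +_; -[1+_]; ∣_∣; -_)
open import Data.List using (List; []; _∷_; map; foldr; upTo; all; filter; length; concatMap; [_])
open import Data.Vec using (Vec; []; _∷_)
import Data.Vec as Vec
open import Relation.Nullary.Decidable using (does)
open import Data.Bool.Properties using (T?)
open import Data.Bool using (T)

-- Formal power series over ℤ in q: coefficient functions.
Series : Set
Series = ℕ → ℤ

sumℤ : List ℤ → ℤ
sumℤ = foldr ℤ._+_ (+ 0)

_⊛_ : Series → Series → Series
(f ⊛ g) k = sumℤ (map (λ i → f i ℤ.* g (k ∸ i)) (upTo (suc k)))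

oneS : Series
oneS zero = + 1
oneS (suc _) = + 0

zeroS : Series
zeroS _ = + 0

oneMinusQ : ℕ → Series
oneMinusQ j zero = + 1
oneMinusQ j (suc k) = if k ≡ᵇ j then - (+ 1) else + 0

qPoch : ℕ → Series
qPoch zero = oneS
qPoch (suc m) = qPoch m ⊛ oneMinusQ m

-- 1/(1 - q^(suc j)) = Σ_t q^{(suc j) t}
geom : ℕ → Series
geom j k = if (k % suc j) ≡ᵇ 0 then + 1 else + 0

qPochInv : ℕ → Series
qPochInv zero = oneS
qPochInv (suc m) = qPochInv m ⊛ geom m

gauss : ℕ → ℕ → Series
gauss a b k = if b ≤ᵇ a then ((qPoch a ⊛ qPochInv b) ⊛ qPochInv (a ∸ b)) k else + 0

gaussℤ : ℕ → ℤ → Series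
gaussℤ a (+ b) = gauss a b
gaussℤ a -[1+ _ ] = zeroS

-- Cylindric partitions of profile (3,1), each partition with ≤ n parts.
-- A partition with at most n parts is a weakly decreasing Vec ℕ n
-- (padded with zeros). nth v i is the (i+1)-th part (0-indexed), 0 beyond n.

nth : ∀ {n} → Vec ℕ n → ℕ → ℕ
nth [] _ = 0
nth (x ∷ v) zero = x
nth (x ∷ v) (suc i) = nth v i

sumV : ∀ {n} → Vec ℕ n → ℕ
sumV = Vec.foldr _ ℕ._+_ 0

vecsUpTo : (n b : ℕ) → List (Vec ℕ n)
vecsUpTo zero b = [ [] ]
vecsUpTo (suc n) b = concatMap (λ x → map (x ∷_) (vecsUpTo n b)) (upTo (suc b))

-- profile (c₁,c₂) = (3,1); conditions (0-indexed i = j-1):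
--   λ¹ weakly decreasing, λ² weakly decreasing,
--   λ¹_j ≥ λ²_{j+c₂} = λ²_{j+1},   λ²_j ≥ λ¹_{j+c₁} = λ¹_{j+3}.
-- For i ≥ n all entries involved are 0, so checking i < n suffices.
isCyl31 : ∀ {n} → Vec ℕ n → Vec ℕ n → Bool
isCyl31 {n} l1 l2 =
  all (λ i → (nth l1 (suc i) ≤ᵇ nth l1 i) ∧ (nth l2 (suc i) ≤ᵇ nth l2 i)
           ∧ (nth l2 (i ℕ.+ 1) ≤ᵇ nth l1 i) ∧ (nth l1 (i ℕ.+ 3) ≤ᵇ nth l2 i))
      (upTo n)

record Pair (n : ℕ) : Set where
  constructor _,,_
  field fst : Vec ℕ n
        snd : Vec ℕ n

-- number of cylindric partitions of profile (3,1), ≤ n parts each, of size k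
-- (every part is ≤ k, so enumerating entries in {0,…,k} is exhaustive)
cp31Count : ℕ → ℕ → ℕ
cp31Count n k =
  length (filter (λ p → T? (isCyl31 (Pair.fst p) (Pair.snd p)
                           ∧ ((sumV (Pair.fst p) ℕ.+ sumV (Pair.snd p)) ≡ᵇ k)))
                 (concatMap (λ l1 → map (l1 ,,_) (vecsUpTo n k)) (vecsUpTo n k)))

CP31 : ℕ → Series
CP31 n k = + cp31Count n k

-- Right-hand side: Σ_{r∈ℤ} (-1)^r q^{r(3r+1)} [2n ; n - 3r + ((-1)^r - 1)/2]_q
-- ((-1)^r - 1)/2 = 0 for r even and -1 for r odd, i.e. -(|r| mod 2).

rhsTerm : ℕ → ℤ → Series
rhsTerm n r k =
  let e = ∣ r ℤ.* (+ 3 ℤ.* r ℤ.+ + 1) ∣          -- r(3r+1) ≥ 0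
      b = + n ℤ.- + 3 ℤ.* r ℤ.- + (∣ r ∣ % 2)
  in if e ≤ᵇ k then (- (+ 1)) ℤ.^ ∣ r ∣ ℤ.* gaussℤ (2 ℕ.* n) b (k ∸ e) else + 0

symRange : ℕ → List ℤ
symRange N = map (λ i → + i ℤ.- + N) (upTo (suc (2 ℕ.* N)))

-- coefficient of q^k in the bilateral sum; terms with |r| > k have
-- r(3r+1) ≥ 2r² > k and contribute nothing to q^k, so the sum over
-- -k ≤ r ≤ k is the full coefficient.
RHS : ℕ → Series
RHS n k = sumℤ (map (λ r → rhsTerm n r k) (symRange k))

{-# OPTIONS --safe #-}

-- Let F(a,b) be the generating function of the cylindric partitions whose first partition has at
-- most a parts and whose second has at most b.  Splitting according to which of the last parts vanish, and
-- subtracting 1 from all parts when none does, gives for -1 ≤ a - b ≤ 3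
--   F(a,b) = F(a-1,b) + F(a,b-1) - F(a-1,b-1) + q^(a+b) F(a,b),
-- while the interlacing conditions give F(m,m+2) = F(m,m+1) and F(m+4,m) = F(m+3,m).
-- These relations determine F.  Every H(a-c,b+c), where H(i,j) = 1/((q)ᵢ (q)ⱼ), solves the
-- recurrence, and the combination
--   S(a,b) = Σₛ q^e(-2s) H(a-6s, b+6s) - q^e(2s+1) H(a-6s-4, b+6s+4),   e(r) = r(3r+1),
-- also satisfies both boundary conditions, because the terms of the differences cancel in pairs
-- (a reflection principle).  Multiplying F(n,n) = S(n,n) by (q)₂ₙ gives the claim.
module Submission where

open import Defs
open import Data.Bool using (Bool; true; false; if_then_else_; T; _∧_)
open import Data.Bool.Properties using (T?; T-∧; T-≡; ⇔→≡)
open import Data.Empty using (⊥-elim)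
open import Data.Integer as ℤ using (ℤ; +_; -[1+_]; _+_; _-_; -_; 0ℤ; 1ℤ; -1ℤ) renaming (_*_ to _·_; ∣_∣ to abs)
import Data.Integer.Properties as ℤₚ
open import Data.Integer.Tactic.RingSolver using (solve-∀)
open import Data.List using (List; []; _∷_; _++_; map; upTo; concatMap; filter; length)
open import Data.List.Properties using (map-upTo; map-∘; upTo-∷ʳ)
open import Data.List.Relation.Unary.All.Properties using (all⁺; all⁻; applyUpTo⁺₁; applyUpTo⁻)
open import Data.Nat as ℕ using (ℕ; zero; suc; _*_; _∸_; _≤_; _<_; z≤n; s≤s; _≤ᵇ_; _≡ᵇ_)
import Data.Nat.DivMod as ℕ/
import Data.Nat.Properties as ℕₚ
open import Data.Product using (_,_; _×_; ∃; proj₁; proj₂)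
open import Data.Sum using (inj₁; inj₂)
open import Data.Vec using (Vec; []; _∷_; replicate)
open import Function using (_∘_; id; mk⇔; Equivalence)
open import Relation.Binary.PropositionalEquality using (_≡_; _≗_; refl; sym; trans; cong; cong₂; subst; module ≡-Reasoning)

-- Replacing (a,b) by (a-c,b+c) keeps a+b, which is why every shifted `H` solves the recurrence. On
-- the line b = a+2, exchanging the two indices of `H` amounts to c ↦ -2-c, and on a = b+4 to c ↦
-- 4-c. The orbit of 0 under these reflections consists of the offsets 6s and, with sign -1, 6s+4.
-- Cancellation then forces the exponents: they change by 2+2c along the first reflection and by
-- 4-2c along the second. Starting from 0 at c = 0, this gives e(-2s) and e(2s+1). The strip has its
-- width because adding 1 to the first a and the first b parts preserves the interlacing in general
-- only if b ≤ a+1 and a ≤ b+3. The boundary relations bring back the two neighbours that lie just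
-- outside. Series are coefficient functions, so both sides are truncated: the finite sum `S K`
-- meets the boundary relations up to degree K, and partitions enumerated with entries at most B are
-- complete up to degree B. The comparison is therefore made for k ≤ B ≤ K.

private variable
  A B : Set
  n : ℕ

-- Finite sums

∑ : List A → (A → ℤ) → ℤ
∑ xs f = sumℤ (map f xs)

∑-cong : {f g : A → ℤ} (xs : List A) → f ≗ g → ∑ xs f ≡ ∑ xs g
∑-cong []       f≗g = refl
∑-cong (x ∷ xs) f≗g = cong₂ _+_ (f≗g x) (∑-cong xs f≗g)

∑-zero : {f : A → ℤ} (xs : List A) → (∀ x → f x ≡ 0ℤ) → ∑ xs f ≡ 0ℤ
∑-zero []       f≗0 = refl
∑-zero (x ∷ xs) f≗0 = cong₂ _+_ (f≗0 x) (∑-zero xs f≗0)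

interchange : ∀ a b c d → (a + b) + (c + d) ≡ (a + c) + (b + d)
interchange = solve-∀

∑-+ : (xs : List A) (f g : A → ℤ) → ∑ xs (λ x → f x + g x) ≡ ∑ xs f + ∑ xs g
∑-+ []       f g = refl
∑-+ (x ∷ xs) f g = trans (cong (_+_ (f x + g x)) (∑-+ xs f g)) (interchange (f x) (g x) (∑ xs f) (∑ xs g))

∑-·ˡ : (xs : List A) (c : ℤ) (f : A → ℤ) → ∑ xs (λ x → c · f x) ≡ c · ∑ xs f
∑-·ˡ []       c f = sym (ℤₚ.*-zeroʳ c)
∑-·ˡ (x ∷ xs) c f = trans (cong (_+_ (c · f x)) (∑-·ˡ xs c f)) (sym (ℤₚ.*-distribˡ-+ c (f x) (∑ xs f)))

∑-neg : (xs : List A) (f : A → ℤ) → ∑ xs (λ x → - f x) ≡ - ∑ xs f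
∑-neg []       f = refl
∑-neg (x ∷ xs) f = trans (cong (_+_ (- f x)) (∑-neg xs f)) (sym (ℤₚ.neg-distrib-+ (f x) (∑ xs f)))

∑-++ : (xs ys : List A) (f : A → ℤ) → ∑ (xs ++ ys) f ≡ ∑ xs f + ∑ ys f
∑-++ []       ys f = sym (ℤₚ.+-identityˡ _)
∑-++ (x ∷ xs) ys f = trans (cong (_+_ (f x)) (∑-++ xs ys f)) (sym (ℤₚ.+-assoc (f x) _ _))

∑-map : (g : A → B) (xs : List A) (f : B → ℤ) → ∑ (map g xs) f ≡ ∑ xs (f ∘ g)
∑-map g xs f = cong sumℤ (sym (map-∘ xs))

∑-concatMap : (g : A → List B) (xs : List A) (f : B → ℤ) → ∑ (concatMap g xs) f ≡ ∑ xs (λ x → ∑ (g x) f)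
∑-concatMap g []       f = refl
∑-concatMap g (x ∷ xs) f = trans (∑-++ (g x) (concatMap g xs) f) (cong (_+_ (∑ (g x) f)) (∑-concatMap g xs f))

∑-upTo-suc : ∀ n (f : ℕ → ℤ) → ∑ (upTo (suc n)) f ≡ f 0 + ∑ (upTo n) (f ∘ suc)
∑-upTo-suc n f = cong (λ z → f 0 + sumℤ z)
  (trans (cong (map f) (sym (map-upTo suc n))) (sym (map-∘ (upTo n))))

∑-upTo-last : ∀ n (f : ℕ → ℤ) → ∑ (upTo (suc n)) f ≡ ∑ (upTo n) f + f n
∑-upTo-last n f = trans (cong (λ z → ∑ z f) (sym (upTo-∷ʳ n)))
  (trans (∑-++ (upTo n) (n ∷ []) f) (cong (_+_ (∑ (upTo n) f)) (ℤₚ.+-identityʳ (f n))))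

ι : Bool → ℤ
ι b = if b then 1ℤ else 0ℤ

length-filter : (p : A → Bool) (xs : List A) → + length (filter (T? ∘ p) xs) ≡ ∑ xs (ι ∘ p)
length-filter p []       = refl
length-filter p (x ∷ xs) with p x
... | true  = cong (_+_ (1ℤ)) (length-filter p xs)
... | false = trans (length-filter p xs) (sym (ℤₚ.+-identityˡ _))

-- Power series

⊛-zero : ∀ f g → (f ⊛ g) 0 ≡ f 0 · g 0
⊛-zero f g = ℤₚ.+-identityʳ _

⊛-suc : ∀ f g k → (f ⊛ g) (suc k) ≡ f 0 · g (suc k) + ((f ∘ suc) ⊛ g) k
⊛-suc f g k = ∑-upTo-suc (suc k) (λ i → f i · g (suc k ∸ i))

⊛-cong : ∀ {f f′ g g′} → f ≗ f′ → g ≗ g′ → f ⊛ g ≗ f′ ⊛ g′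
⊛-cong f≗ g≗ k = ∑-cong (upTo (suc k)) (λ i → cong₂ _·_ (f≗ i) (g≗ (k ∸ i)))

⊛-cong-≤ : ∀ f {g g′} k → (∀ x → x ≤ k → g x ≡ g′ x) → (f ⊛ g) k ≡ (f ⊛ g′) k
⊛-cong-≤ f k g≡ = ∑-cong (upTo (suc k)) (λ i → cong (f i ·_) (g≡ (k ∸ i) (ℕₚ.m∸n≤m k i)))

⊛-zeroʳ : ∀ f {g} → g ≗ zeroS → f ⊛ g ≗ zeroS
⊛-zeroʳ f g≗ k = ∑-zero (upTo (suc k)) (λ i → trans (cong (f i ·_) (g≗ (k ∸ i))) (ℤₚ.*-zeroʳ (f i)))

⊛-distribʳ-+ : ∀ f g h → (λ x → f x + g x) ⊛ h ≗ λ x → (f ⊛ h) x + (g ⊛ h) x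
⊛-distribʳ-+ f g h k = trans
  (∑-cong (upTo (suc k)) (λ i → ℤₚ.*-distribʳ-+ (h (k ∸ i)) (f i) (g i)))
  (∑-+ (upTo (suc k)) (λ i → f i · h (k ∸ i)) (λ i → g i · h (k ∸ i)))

⊛-·ˡ : ∀ c f g → (λ x → c · f x) ⊛ g ≗ λ x → c · (f ⊛ g) x
⊛-·ˡ c f g k = trans
  (∑-cong (upTo (suc k)) (λ i → ℤₚ.*-assoc c (f i) (g (k ∸ i))))
  (∑-·ˡ (upTo (suc k)) c _)

⊛-assoc : ∀ f g h → (f ⊛ g) ⊛ h ≗ f ⊛ (g ⊛ h)
⊛-assoc f g h zero = begin
  ((f ⊛ g) ⊛ h) 0        ≡⟨ ⊛-zero (f ⊛ g) h ⟩
  (f ⊛ g) 0 · h 0        ≡⟨ cong (_· h 0) (⊛-zero f g) ⟩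
  f 0 · g 0 · h 0        ≡⟨ ℤₚ.*-assoc (f 0) (g 0) (h 0) ⟩
  f 0 · (g 0 · h 0)      ≡⟨ cong (f 0 ·_) (⊛-zero g h) ⟨
  f 0 · (g ⊛ h) 0        ≡⟨ ⊛-zero f (g ⊛ h) ⟨
  (f ⊛ (g ⊛ h)) 0        ∎
  where open ≡-Reasoning
⊛-assoc f g h (suc k) = begin
  ((f ⊛ g) ⊛ h) (suc k)
    ≡⟨ ⊛-suc (f ⊛ g) h k ⟩
  (f ⊛ g) 0 · h (suc k) + (((f ⊛ g) ∘ suc) ⊛ h) k
    ≡⟨ cong₂ (λ x y → x · h (suc k) + y) (⊛-zero f g) (⊛-cong {g = h} (⊛-suc f g) (λ _ → refl) k) ⟩
  f 0 · g 0 · h (suc k) + ((λ x → f 0 · g (suc x) + ((f ∘ suc) ⊛ g) x) ⊛ h) k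
    ≡⟨ cong (_+_ (f 0 · g 0 · h (suc k))) (⊛-distribʳ-+ (λ x → f 0 · g (suc x)) ((f ∘ suc) ⊛ g) h k) ⟩
  f 0 · g 0 · h (suc k) + (((λ x → f 0 · g (suc x)) ⊛ h) k + (((f ∘ suc) ⊛ g) ⊛ h) k)
    ≡⟨ cong (_+_ (f 0 · g 0 · h (suc k))) (cong₂ _+_ (⊛-·ˡ (f 0) (g ∘ suc) h k) (⊛-assoc (f ∘ suc) g h k)) ⟩
  f 0 · g 0 · h (suc k) + (f 0 · ((g ∘ suc) ⊛ h) k + ((f ∘ suc) ⊛ (g ⊛ h)) k)
    ≡⟨ regroup (f 0) (g 0) (h (suc k)) _ _ ⟩
  f 0 · (g 0 · h (suc k) + ((g ∘ suc) ⊛ h) k) + ((f ∘ suc) ⊛ (g ⊛ h)) k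
    ≡⟨ cong (λ x → f 0 · x + ((f ∘ suc) ⊛ (g ⊛ h)) k) (⊛-suc g h k) ⟨
  f 0 · (g ⊛ h) (suc k) + ((f ∘ suc) ⊛ (g ⊛ h)) k
    ≡⟨ ⊛-suc f (g ⊛ h) k ⟨
  (f ⊛ (g ⊛ h)) (suc k) ∎
  where
  open ≡-Reasoning
  regroup : ∀ a b c d e → a · b · c + (a · d + e) ≡ a · (b · c + d) + e
  regroup = solve-∀

-- `⊛-suc` splits off the constant coefficient of the left factor, this the one of the right factor.
-- Together they make commutativity, and shifts of the right factor, inductions on the coefficient.
⊛-suc′ : ∀ f g k → (f ⊛ g) (suc k) ≡ (f ⊛ (g ∘ suc)) k + f (suc k) · g 0
⊛-suc′ f g zero = trans (⊛-suc f g 0)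
  (cong₂ _+_ (sym (⊛-zero f (g ∘ suc))) (⊛-zero (f ∘ suc) g))
⊛-suc′ f g (suc k) = begin
  (f ⊛ g) (suc (suc k))
    ≡⟨ ⊛-suc f g (suc k) ⟩
  f 0 · g (suc (suc k)) + ((f ∘ suc) ⊛ g) (suc k)
    ≡⟨ cong (_+_ (f 0 · g (suc (suc k)))) (⊛-suc′ (f ∘ suc) g k) ⟩
  f 0 · g (suc (suc k)) + (((f ∘ suc) ⊛ (g ∘ suc)) k + f (suc (suc k)) · g 0)
    ≡⟨ ℤₚ.+-assoc (f 0 · g (suc (suc k))) _ _ ⟨
  f 0 · g (suc (suc k)) + ((f ∘ suc) ⊛ (g ∘ suc)) k + f (suc (suc k)) · g 0
    ≡⟨ cong (_+ f (suc (suc k)) · g 0) (⊛-suc f (g ∘ suc) k) ⟨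
  (f ⊛ (g ∘ suc)) (suc k) + f (suc (suc k)) · g 0 ∎
  where open ≡-Reasoning

⊛-comm : ∀ f g → f ⊛ g ≗ g ⊛ f
⊛-comm f g zero = trans (⊛-zero f g) (trans (ℤₚ.*-comm (f 0) (g 0)) (sym (⊛-zero g f)))
⊛-comm f g (suc k) = begin
  (f ⊛ g) (suc k)                        ≡⟨ ⊛-suc f g k ⟩
  f 0 · g (suc k) + ((f ∘ suc) ⊛ g) k      ≡⟨ cong₂ _+_ (ℤₚ.*-comm (f 0) (g (suc k))) (⊛-comm (f ∘ suc) g k) ⟩
  g (suc k) · f 0 + (g ⊛ (f ∘ suc)) k      ≡⟨ ℤₚ.+-comm (g (suc k) · f 0) _ ⟩
  (g ⊛ (f ∘ suc)) k + g (suc k) · f 0      ≡⟨ ⊛-suc′ g f k ⟨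
  (g ⊛ f) (suc k)                        ∎
  where open ≡-Reasoning

⊛-distribˡ-+ : ∀ f g h → f ⊛ (λ x → g x + h x) ≗ λ x → (f ⊛ g) x + (f ⊛ h) x
⊛-distribˡ-+ f g h k = trans
  (∑-cong (upTo (suc k)) (λ i → ℤₚ.*-distribˡ-+ (f i) (g (k ∸ i)) (h (k ∸ i))))
  (∑-+ (upTo (suc k)) (λ i → f i · g (k ∸ i)) (λ i → f i · h (k ∸ i)))

⊛-negʳ : ∀ f g → f ⊛ (λ x → - g x) ≗ λ x → - (f ⊛ g) x
⊛-negʳ f g k = trans
  (∑-cong (upTo (suc k)) (λ i → sym (ℤₚ.neg-distribʳ-* (f i) (g (k ∸ i)))))
  (∑-neg (upTo (suc k)) (λ i → f i · g (k ∸ i)))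

⊛-∑ : ∀ f (xs : List A) (g : A → Series) → f ⊛ (λ x → ∑ xs (λ t → g t x)) ≗ λ x → ∑ xs (λ t → (f ⊛ g t) x)
⊛-∑ f []       g k = ⊛-zeroʳ f (λ _ → refl) k
⊛-∑ f (t ∷ ts) g k = trans (⊛-distribˡ-+ f (g t) (λ x → ∑ ts (λ u → g u x)) k)
  (cong (_+_ ((f ⊛ g t) k)) (⊛-∑ f ts g k))

⊛-oneʳ : ∀ f → f ⊛ oneS ≗ f
⊛-oneʳ f k = trans (⊛-comm f oneS k) (one⊛ k)
  where
  one⊛ : ∀ k → (oneS ⊛ f) k ≡ f k
  one⊛ zero    = trans (⊛-zero oneS f) (ℤₚ.*-identityˡ (f 0))
  one⊛ (suc k) = trans (⊛-suc oneS f k) (trans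
    (cong₂ _+_ (ℤₚ.*-identityˡ (f (suc k))) (trans (⊛-comm zeroS f k) (⊛-zeroʳ f (λ _ → refl) k)))
    (ℤₚ.+-identityʳ _))

-- sh m is multiplication by q^m.
sh : ℕ → Series → Series
sh zero    f k       = f k
sh (suc m) f zero    = 0ℤ
sh (suc m) f (suc k) = sh m f k

sh-cong : ∀ m {f g} → f ≗ g → sh m f ≗ sh m g
sh-cong zero    f≗g k       = f≗g k
sh-cong (suc m) f≗g zero    = refl
sh-cong (suc m) f≗g (suc k) = sh-cong m f≗g k

sh-zero : ∀ m {f} → f ≗ zeroS → sh m f ≗ zeroS
sh-zero zero    f≗0 k       = f≗0 k
sh-zero (suc m) f≗0 zero    = refl
sh-zero (suc m) f≗0 (suc k) = sh-zero m f≗0 k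

sh-lin : ∀ m f g → sh m (λ x → f x + g x) ≗ λ x → sh m f x + sh m g x
sh-lin zero    f g k       = refl
sh-lin (suc m) f g zero    = refl
sh-lin (suc m) f g (suc k) = sh-lin m f g k

sh-neg : ∀ m f → sh m (λ x → - f x) ≗ λ x → - sh m f x
sh-neg zero    f k       = refl
sh-neg (suc m) f zero    = refl
sh-neg (suc m) f (suc k) = sh-neg m f k

sh-·ˡ : ∀ m c f → sh m (λ x → c · f x) ≗ λ x → c · sh m f x
sh-·ˡ zero    c f k       = refl
sh-·ˡ (suc m) c f zero    = sym (ℤₚ.*-zeroʳ c)
sh-·ˡ (suc m) c f (suc k) = sh-·ˡ m c f k

sh-∑ : ∀ m (xs : List A) (g : A → Series) → sh m (λ x → ∑ xs (λ t → g t x)) ≗ λ x → ∑ xs (λ t → sh m (g t) x)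
sh-∑ m []       g k = sh-zero m (λ _ → refl) k
sh-∑ m (t ∷ ts) g k = trans (sh-lin m (g t) _ k) (cong (_+_ (sh m (g t) k)) (sh-∑ m ts g k))

sh-+ : ∀ m n f → sh (m ℕ.+ n) f ≗ sh m (sh n f)
sh-+ zero    n f k       = refl
sh-+ (suc m) n f zero    = refl
sh-+ (suc m) n f (suc k) = sh-+ m n f k

sh-comm : ∀ m n f → sh m (sh n f) ≗ sh n (sh m f)
sh-comm m n f k = trans (sym (sh-+ m n f k)) (trans (cong (λ z → sh z f k) (ℕₚ.+-comm m n)) (sh-+ n m f k))

sh-< : ∀ {m k} f → k < m → sh m f k ≡ 0ℤ
sh-< {suc m} {zero}  f _         = refl
sh-< {suc m} {suc k} f (s≤s k<m) = sh-< f k<m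

sh-≤ : ∀ m f k → sh m f (m ℕ.+ k) ≡ f k
sh-≤ zero    f k = refl
sh-≤ (suc m) f k = sh-≤ m f k

sh-≡-if : ∀ m f k → sh m f k ≡ (if m ≤ᵇ k then f (k ∸ m) else 0ℤ)
sh-≡-if zero    f k       = refl
sh-≡-if (suc m) f zero    = refl
sh-≡-if (suc zero)    f (suc k) = refl
sh-≡-if (suc (suc m)) f (suc k) = sh-≡-if (suc m) f k

sh-⊛ : ∀ m f g → f ⊛ sh m g ≗ sh m (f ⊛ g)
sh-⊛ zero    f g k       = refl
sh-⊛ (suc m) f g zero    = trans (⊛-zero f (sh (suc m) g)) (ℤₚ.*-zeroʳ (f 0))
sh-⊛ (suc m) f g (suc k) = trans (⊛-suc′ f (sh (suc m) g) k)
  (trans (cong₂ _+_ (sh-⊛ m f g k) (ℤₚ.*-zeroʳ (f (suc k)))) (ℤₚ.+-identityʳ _))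

-- The power of q in front of X is positive, so each coefficient of the shifted series is a lower
-- coefficient of X and strong induction applies. The bound M is carried along because truncated
-- series agree only up to a degree.
fixpoint-unique : ∀ N {X Y R R′ : Series} M →
  (∀ k → k ≤ M → X k ≡ R k + sh (suc N) X k) →
  (∀ k → k ≤ M → Y k ≡ R′ k + sh (suc N) Y k) →
  (∀ k → k ≤ M → R k ≡ R′ k) → ∀ k → k ≤ M → X k ≡ Y k
fixpoint-unique N {X} {Y} {R} {R′} M eqX eqY eqR k k≤M = go (suc k) k ℕₚ.≤-refl k≤M
  where
  sh-agree : ∀ m b → (∀ k → k < b → k ≤ M → X k ≡ Y k) → ∀ k → k < suc m ℕ.+ b → k ≤ M → sh (suc m) X k ≡ sh (suc m) Y k
  sh-agree m b X≡Y k k<m+b k≤M with ℕₚ.<-≤-connex k (suc m)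
  ... | inj₁ k<m = trans (sh-< X k<m) (sym (sh-< Y k<m))
  ... | inj₂ m≤k with ℕₚ.m≤n⇒∃[o]m+o≡n m≤k
  ... | o , refl = trans (sh-≤ (suc m) X o) (trans
    (X≡Y o (ℕₚ.+-cancelˡ-< (suc m) o b k<m+b) (ℕₚ.≤-trans (ℕₚ.m≤n+m o (suc m)) k≤M))
    (sym (sh-≤ (suc m) Y o)))

  go : ∀ b k → k < b → k ≤ M → X k ≡ Y k
  go (suc b) k (s≤s k≤b) k≤M = trans (eqX k k≤M) (trans
    (cong₂ _+_ (eqR k k≤M) (sh-agree N b (go b) k (s≤s (ℕₚ.≤-trans k≤b (ℕₚ.m≤n+m b N))) k≤M))
    (sym (eqY k k≤M)))

-- The series 1/((q)ᵢ (q)ⱼ)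

geom-rec : ∀ j x → geom j x ≡ oneS x + sh (suc j) (geom j) x
geom-rec j x with ℕₚ.<-≤-connex x (suc j)
geom-rec j zero    | inj₁ _   = refl
geom-rec j (suc x) | inj₁ x<j rewrite ℕ/.m<n⇒m%n≡m x<j | sh-< (geom j) x<j = refl
geom-rec j x       | inj₂ j≤x with ℕₚ.m≤n⇒∃[o]m+o≡n j≤x
... | o , refl = trans
  (cong (λ z → if z ≡ᵇ 0 then 1ℤ else 0ℤ) (trans (cong (ℕ._% suc j) (ℕₚ.+-comm (suc j) o)) (ℕ/.[m+n]%n≡m%n o (suc j))))
  (trans (sym (sh-≤ (suc j) (geom j) o)) (sym (ℤₚ.+-identityˡ _)))

qPochInv-rec : ∀ m x → qPochInv (suc m) x ≡ qPochInv m x + sh (suc m) (qPochInv (suc m)) x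
qPochInv-rec m x = begin
  (p ⊛ geom m) x                                           ≡⟨ ⊛-cong {f = p} (λ _ → refl) (geom-rec m) x ⟩
  (p ⊛ (λ y → oneS y + sh (suc m) (geom m) y)) x           ≡⟨ ⊛-distribˡ-+ p oneS (sh (suc m) (geom m)) x ⟩
  (p ⊛ oneS) x + (p ⊛ sh (suc m) (geom m)) x               ≡⟨ cong₂ _+_ (⊛-oneʳ p x) (sh-⊛ (suc m) p (geom m) x) ⟩
  p x + sh (suc m) (p ⊛ geom m) x                          ∎
  where
  open ≡-Reasoning
  p = qPochInv m

-- Zero at negative indices is what keeps (1 - q^i)/(q)ᵢ = 1/(q)ᵢ₋₁ true at i = 0, where the factor
-- 1 - q^0 vanishes. At negative i both sides are zero, so the absolute value in the exponent is
-- harmless.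
qPochInvℤ : ℤ → Series
qPochInvℤ (+ m)    = qPochInv m
qPochInvℤ -[1+ _ ] = zeroS

qPochInvℤ-pred : ∀ i x → qPochInvℤ (i - 1ℤ) x ≡ qPochInvℤ i x - sh (abs i) (qPochInvℤ i) x
qPochInvℤ-pred (+ zero)  x = sym (ℤₚ.+-inverseʳ (oneS x))
qPochInvℤ-pred (+ suc m) x = sym (trans (cong (_- s) (qPochInv-rec m x)) (cancel (qPochInv m x) s))
  where
  s = sh (suc m) (qPochInv (suc m)) x
  cancel : ∀ a b → a + b - b ≡ a
  cancel = solve-∀
qPochInvℤ-pred -[1+ m ]  x = cong (λ z → 0ℤ - z) (sym (sh-zero (suc m) (λ _ → refl) x))

-- Negativity is expressed by an equation with a natural witness, so that the ring solver can
-- establish it.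
qPochInvℤ-neg : ∀ {i} w → i ≡ -1ℤ - + w → qPochInvℤ i ≗ zeroS
qPochInvℤ-neg zero    refl _ = refl
qPochInvℤ-neg (suc w) refl _ = refl

H : ℤ → ℤ → Series
H i j = qPochInvℤ i ⊛ qPochInvℤ j

H-comm : ∀ i j → H i j ≗ H j i
H-comm i j = ⊛-comm (qPochInvℤ i) (qPochInvℤ j)

H-zeroʳ : ∀ i j → qPochInvℤ j ≗ zeroS → H i j ≗ zeroS
H-zeroʳ i j = ⊛-zeroʳ (qPochInvℤ i)

H-zeroˡ : ∀ i j → qPochInvℤ i ≗ zeroS → H i j ≗ zeroS
H-zeroˡ i j i≗0 x = trans (H-comm i j x) (H-zeroʳ j i i≗0 x)

H-predʳ : ∀ i j x → H i (j - 1ℤ) x ≡ H i j x - sh (abs j) (H i j) x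
H-predʳ i j x = begin
  H i (j - 1ℤ) x                                            ≡⟨ ⊛-cong {f = qPochInvℤ i} (λ _ → refl) (qPochInvℤ-pred j) x ⟩
  (qPochInvℤ i ⊛ (λ y → qPochInvℤ j y - s y)) x             ≡⟨ ⊛-distribˡ-+ (qPochInvℤ i) (qPochInvℤ j) (λ y → - s y) x ⟩
  H i j x + (qPochInvℤ i ⊛ (λ y → - s y)) x                 ≡⟨ cong (_+_ (H i j x)) (⊛-negʳ (qPochInvℤ i) s x) ⟩
  H i j x - (qPochInvℤ i ⊛ s) x                             ≡⟨ cong (λ z → H i j x - z) (sh-⊛ (abs j) (qPochInvℤ i) (qPochInvℤ j) x) ⟩
  H i j x - sh (abs j) (H i j) x                              ∎
  where
  open ≡-Reasoning
  s = sh (abs j) (qPochInvℤ j)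

H-predˡ : ∀ i j x → H (i - 1ℤ) j x ≡ H i j x - sh (abs i) (H i j) x
H-predˡ i j x = trans (H-comm (i - 1ℤ) j x) (trans (H-predʳ j i x)
  (cong₂ _-_ (H-comm j i x) (sh-cong (abs i) (H-comm j i) x)))

-- Absolute values add when both indices are nonnegative; otherwise `H i j` is zero and the
-- exponents are irrelevant.
sh-sh-H : ∀ i j x → sh (abs j) (sh (abs i) (H i j)) x ≡ sh (abs (i + j)) (H i j) x
sh-sh-H (+ m) (+ n) x = trans (sh-comm n m (H (+ m) (+ n)) x) (sym (sh-+ m n (H (+ m) (+ n)) x))
sh-sh-H (+ m) -[1+ n ] x = trans (sh-zero (suc n) (sh-zero m h≗0) x) (sym (sh-zero (abs (+ m + -[1+ n ])) h≗0 x))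
  where h≗0 = H-zeroʳ (+ m) -[1+ n ] (λ _ → refl)
sh-sh-H -[1+ m ] j x = trans (sh-zero (abs j) (sh-zero (suc m) h≗0) x) (sym (sh-zero (abs (-[1+ m ] + j)) h≗0 x))
  where h≗0 = H-zeroˡ -[1+ m ] j (λ _ → refl)

-- Lowering i or j multiplies `H i j` by 1 - q^i or 1 - q^j, so this is the identity 1 = (1-u) +
-- (1-v) - (1-u)(1-v) + uv with u = q^i, v = q^j.
H-rec : ∀ i j x → H i j x ≡
  H (i - 1ℤ) j x + H i (j - 1ℤ) x - H (i - 1ℤ) (j - 1ℤ) x + sh (abs (i + j)) (H i j) x
H-rec i j x = sym (begin
  H (i - 1ℤ) j x + H i (j - 1ℤ) x - H (i - 1ℤ) (j - 1ℤ) x + sh (abs (i + j)) h x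
    ≡⟨ cong₂ _+_ (cong₂ _-_ (cong₂ _+_ (H-predˡ i j x) (H-predʳ i j x)) corner) (sym (sh-sh-H i j x)) ⟩
  (h x - sh (abs i) h x) + (h x - sh (abs j) h x) - (h x - sh (abs i) h x - (sh (abs j) h x - sh (abs j) (sh (abs i) h) x)) + sh (abs j) (sh (abs i) h) x
    ≡⟨ cancel (h x) (sh (abs i) h x) (sh (abs j) h x) (sh (abs j) (sh (abs i) h) x) ⟩
  h x ∎)
  where
  open ≡-Reasoning
  h = H i j

  cancel : ∀ h a b c → (h - a) + (h - b) - (h - a - (b - c)) + c ≡ h
  cancel = solve-∀

  corner : H (i - 1ℤ) (j - 1ℤ) x ≡ h x - sh (abs i) h x - (sh (abs j) h x - sh (abs j) (sh (abs i) h) x)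
  corner = trans (H-predʳ (i - 1ℤ) j x) (cong₂ _-_ (H-predˡ i j x)
    (trans (sh-cong (abs j) (H-predˡ i j) x)
    (trans (sh-lin (abs j) h (λ y → - sh (abs i) h y) x)
           (cong (_+_ (sh (abs j) h x)) (sh-neg (abs j) (sh (abs i) h) x)))))

-- The reflection: `H` is symmetric, so two terms with exchanged indices agree once their total
-- exponents E + j and E′ + i do. If an index is negative, both sides are zero.
sh-H-swap : ∀ {i i′ j j′} E E′ → i′ ≡ j → j′ ≡ i → + E + j ≡ + E′ + i →
  sh E (sh (abs j) (H i j)) ≗ sh E′ (sh (abs j′) (H i′ j′))
sh-H-swap {+ m} {j = + n} E E′ refl refl eq x = begin
  sh E (sh n (H (+ m) (+ n))) x     ≡⟨ sh-+ E n (H (+ m) (+ n)) x ⟨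
  sh (E ℕ.+ n) (H (+ m) (+ n)) x    ≡⟨ cong (λ z → sh z (H (+ m) (+ n)) x) (ℤₚ.+-injective eq) ⟩
  sh (E′ ℕ.+ m) (H (+ m) (+ n)) x   ≡⟨ sh-+ E′ m (H (+ m) (+ n)) x ⟩
  sh E′ (sh m (H (+ m) (+ n))) x    ≡⟨ sh-cong E′ (sh-cong m (H-comm (+ m) (+ n))) x ⟩
  sh E′ (sh m (H (+ n) (+ m))) x    ∎
  where open ≡-Reasoning
sh-H-swap {+ m} {j = -[1+ n ]} E E′ refl refl eq x =
  trans (sh-zero E (sh-zero (suc n) (H-zeroʳ (+ m) -[1+ n ] (λ _ → refl))) x)
   (sym (sh-zero E′ (sh-zero m (H-zeroˡ -[1+ n ] (+ m) (λ _ → refl))) x))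
sh-H-swap { -[1+ m ]} {j = j} E E′ refl refl eq x =
  trans (sh-zero E (sh-zero (abs j) (H-zeroˡ -[1+ m ] j (λ _ → refl))) x)
   (sym (sh-zero E′ (sh-zero (suc m) (H-zeroʳ j -[1+ m ] (λ _ → refl))) x))

-- The alternating sum

-- The summation index r, split by parity because the offset depends on it: it is -3r for even r =
-- -2s and 3r+1 for odd r = 2s+1.
data Term : Set where
  even odd : ℤ → Term

root : Term → ℤ
root (even s) = - (+ 2 · s)
root (odd s) = + 2 · s + 1ℤ

offset : Term → ℤ
offset (even s) = + 6 · s
offset (odd s) = + 6 · s + + 4

sgn : Term → ℤ
sgn (even _) = 1ℤ
sgn (odd _) = -1ℤ

-- The roots are the r with |r| ≤ 2K+1. Even terms run over -K ≤ s ≤ K and odd ones over -K-1 ≤ s ≤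
-- K, so either reflection matches all even terms and leaves a single odd one.
terms : ℕ → List Term
terms zero    = even 0ℤ ∷ odd 0ℤ ∷ odd -1ℤ ∷ []
terms (suc K) = even (+ suc K) ∷ even -[1+ K ] ∷ odd (+ suc K) ∷ odd -[1+ suc K ] ∷ terms K

expo : ℤ → ℕ
expo r = (abs (r · (+ 3 · r + 1ℤ)))

expo-pos : ∀ r → + expo r ≡ r · (+ 3 · r + 1ℤ)
expo-pos (+ zero)    = refl
expo-pos (+ suc m)   = refl
expo-pos -[1+ m ] rewrite ℕₚ.+-suc m (m ℕ.+ suc (m ℕ.+ 0)) = refl

-- The factor 3r+1 is never 0 for an integer r. This crude bound suffices to push every term with
-- |r| > k beyond degree k.
abs≤expo : ∀ r → abs r ≤ expo r
abs≤expo r = subst (abs r ≤_) (sym (ℤₚ.abs-* r (+ 3 · r + 1ℤ)))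
  (ℕₚ.m≤m*n (abs r) (abs (+ 3 · r + 1ℤ)) ⦃ nz r ⦄)
  where
  nz : ∀ r → ℕ.NonZero (abs (+ 3 · r + 1ℤ))
  nz (+ zero)  = _
  nz (+ suc m) = _
  nz -[1+ m ]  rewrite ℕₚ.+-suc m (m ℕ.+ suc (m ℕ.+ 0)) = _

W : ℤ → ℤ → Term → Series
W a b t = sh (expo (root t)) (H (a - offset t) (b + offset t))

S : ℕ → ℤ → ℤ → Series
S K a b x = ∑ (terms K) (λ t → sgn t · W a b t x)

-- The indices of `H` add up to a+b for every offset, so the shift is the same for all terms and the
-- recurrence passes to their sum.
W-rec : ∀ a b t x → W a b t x ≡
  W (a - 1ℤ) b t x + W a (b - 1ℤ) t x - W (a - 1ℤ) (b - 1ℤ) t x + sh (abs (a + b)) (W a b t) x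
W-rec a b t x = begin
  sh e (H i j) x
    ≡⟨ sh-cong e (λ y → trans (H-rec i j y) (reindex y)) x ⟩
  sh e (λ y → H i′ j y + H i j′ y - H i′ j′ y + sh (abs (a + b)) (H i j) y) x
    ≡⟨ sh-lin e (λ y → H i′ j y + H i j′ y - H i′ j′ y) (sh (abs (a + b)) (H i j)) x ⟩
  sh e (λ y → H i′ j y + H i j′ y - H i′ j′ y) x + sh e (sh (abs (a + b)) (H i j)) x
    ≡⟨ cong₂ _+_ (sh-lin e (λ y → H i′ j y + H i j′ y) (λ y → - H i′ j′ y) x) (sh-comm e (abs (a + b)) (H i j) x) ⟩
  sh e (λ y → H i′ j y + H i j′ y) x + sh e (λ y → - H i′ j′ y) x + sh (abs (a + b)) (sh e (H i j)) x
    ≡⟨ cong (_+ sh (abs (a + b)) (sh e (H i j)) x) (cong₂ _+_ (sh-lin e (H i′ j) (H i j′) x) (sh-neg e (H i′ j′) x)) ⟩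
  sh e (H i′ j) x + sh e (H i j′) x - sh e (H i′ j′) x + sh (abs (a + b)) (sh e (H i j)) x ∎
  where
  open ≡-Reasoning
  e = expo (root t)
  c = offset t
  i = a - c
  j = b + c
  i′ = a - 1ℤ - c
  j′ = b - 1ℤ + c
  i-eq : ∀ a c → a - c - 1ℤ ≡ a - 1ℤ - c
  i-eq = solve-∀
  j-eq : ∀ b c → b + c - 1ℤ ≡ b - 1ℤ + c
  j-eq = solve-∀
  ij-eq : ∀ a b c → (a - c) + (b + c) ≡ a + b
  ij-eq = solve-∀
  reindex : ∀ y → H (i - 1ℤ) j y + H i (j - 1ℤ) y - H (i - 1ℤ) (j - 1ℤ) y + sh (abs (i + j)) (H i j) y
                ≡ H i′ j y + H i j′ y - H i′ j′ y + sh (abs (a + b)) (H i j) y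
  reindex y rewrite i-eq a c | j-eq b c | ij-eq a b c = refl

S-rec : ∀ K a b x → S K a b x ≡
  S K (a - 1ℤ) b x + S K a (b - 1ℤ) x - S K (a - 1ℤ) (b - 1ℤ) x + sh (abs (a + b)) (S K a b) x
S-rec K a b x = begin
  ∑ ts (w a b)
    ≡⟨ ∑-cong ts (λ t → trans (cong (sgn t ·_) (W-rec a b t x)) (expand (sgn t) _ _ _ _)) ⟩
  ∑ ts (λ t → w a⁻ b t + w a b⁻ t + - w a⁻ b⁻ t + s t)
    ≡⟨ ∑-+ ts (λ t → w a⁻ b t + w a b⁻ t + - w a⁻ b⁻ t) s ⟩
  ∑ ts (λ t → w a⁻ b t + w a b⁻ t + - w a⁻ b⁻ t) + ∑ ts s
    ≡⟨ cong₂ _+_ (∑-+ ts (λ t → w a⁻ b t + w a b⁻ t) (λ t → - w a⁻ b⁻ t)) shift ⟩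
  ∑ ts (λ t → w a⁻ b t + w a b⁻ t) + ∑ ts (λ t → - w a⁻ b⁻ t) + sh (abs (a + b)) (S K a b) x
    ≡⟨ cong (_+ sh (abs (a + b)) (S K a b) x) (cong₂ _+_ (∑-+ ts (w a⁻ b) (w a b⁻)) (∑-neg ts (w a⁻ b⁻))) ⟩
  S K a⁻ b x + S K a b⁻ x - S K a⁻ b⁻ x + sh (abs (a + b)) (S K a b) x ∎
  where
  open ≡-Reasoning
  ts = terms K
  a⁻ = a - 1ℤ
  b⁻ = b - 1ℤ
  w : ℤ → ℤ → Term → ℤ
  w a b t = sgn t · W a b t x
  s : Term → ℤ
  s t = sgn t · sh (abs (a + b)) (W a b t) x
  expand : ∀ g p q r u → g · (p + q - r + u) ≡ g · p + g · q + - (g · r) + g · u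
  expand = solve-∀
  shift : ∑ ts s ≡ sh (abs (a + b)) (S K a b) x
  shift = trans (∑-cong ts (λ t → sym (sh-·ˡ (abs (a + b)) (sgn t) (W a b t) x)))
    (sym (sh-∑ (abs (a + b)) ts (λ t y → sgn t · W a b t y) x))

-- Only one endpoint of the range of summation remains unpaired.
∑-terms-pair₁ : (g : Term → ℤ) → (∀ s s′ → s + s′ ≡ -1ℤ → g (even s) + g (odd s′) ≡ 0ℤ) →
  ∀ K → ∑ (terms K) g ≡ g (odd (+ K))
∑-terms-pair₁ g pair zero = trans (regroup (g (even 0ℤ)) (g (odd 0ℤ)) (g (odd -1ℤ)))
  (trans (cong (_+ g (odd 0ℤ)) (pair 0ℤ -1ℤ refl)) (ℤₚ.+-identityˡ _))
  where
  regroup : ∀ a b c → a + (b + (c + 0ℤ)) ≡ a + c + b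
  regroup = solve-∀
∑-terms-pair₁ g pair (suc K) rewrite ∑-terms-pair₁ g pair K =
  trans (regroup (g (even (+ suc K))) (g (even -[1+ K ])) (g (odd (+ suc K))) (g (odd -[1+ suc K ])) (g (odd (+ K))))
  (trans (cong₂ (λ y z → y + z + g (odd (+ suc K)))
    (pair (+ suc K) -[1+ suc K ] (n+-[1+n] (suc K))) (pair -[1+ K ] (+ K) (trans (ℤₚ.+-comm -[1+ K ] (+ K)) (n+-[1+n] K))))
    (ℤₚ.+-identityˡ _))
  where
  regroup : ∀ a b c d e → a + (b + (c + (d + e))) ≡ (a + d) + (b + e) + c
  regroup = solve-∀
  n+-[1+n] : ∀ n → + n + -[1+ n ] ≡ -1ℤ
  n+-[1+n] n = trans (ℤₚ.⊖-< (ℕₚ.n<1+n n)) (cong (λ z → - + z) (ℕₚ.m+n∸n≡m 1 n))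

-- Here s′ = -s exhausts -K ≤ s′ ≤ K, so the lowest odd term is left over; with s′ = -1-s it was the
-- highest.
∑-terms-pair₂ : (g : Term → ℤ) → (∀ s s′ → s + s′ ≡ 0ℤ → g (even s) + g (odd s′) ≡ 0ℤ) →
  ∀ K → ∑ (terms K) g ≡ g (odd -[1+ K ])
∑-terms-pair₂ g pair zero = trans (regroup (g (even 0ℤ)) (g (odd 0ℤ)) (g (odd -1ℤ)))
  (trans (cong (_+ g (odd -1ℤ)) (pair 0ℤ 0ℤ refl)) (ℤₚ.+-identityˡ _))
  where
  regroup : ∀ a b c → a + (b + (c + 0ℤ)) ≡ a + b + c
  regroup = solve-∀
∑-terms-pair₂ g pair (suc K) rewrite ∑-terms-pair₂ g pair K =
  trans (regroup (g (even (+ suc K))) (g (even -[1+ K ])) (g (odd (+ suc K))) (g (odd -[1+ suc K ])) (g (odd -[1+ K ])))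
  (trans (cong₂ (λ y z → y + z + g (odd -[1+ suc K ]))
    (pair (+ suc K) -[1+ K ] (ℤₚ.+-inverseʳ (+ suc K))) (pair -[1+ K ] (+ suc K) (ℤₚ.+-inverseˡ (+ suc K))))
    (ℤₚ.+-identityˡ _))
  where
  regroup : ∀ a b c d e → a + (b + (c + (d + e))) ≡ (a + e) + (b + c) + d
  regroup = solve-∀

-- Boundary relations and initial values of the alternating sum

root-odd⁺-large : ∀ K → K < abs (root (odd (+ K)))
root-odd⁺-large zero    = s≤s z≤n
root-odd⁺-large (suc K) = s≤s (subst (_≤ K ℕ.+ suc (K ℕ.+ 0) ℕ.+ 1) (ℕₚ.+-comm K 1) (ℕₚ.+-monoˡ-≤ 1 (ℕₚ.m≤m+n K _)))

root-odd⁻-large : ∀ K → K < abs (root (odd -[1+ K ]))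
root-odd⁻-large K rewrite ℕₚ.+-suc K (K ℕ.+ 0) = s≤s (ℕₚ.m≤m+n K _)

private
  +-1·-cancel : ∀ {X Y} → X ≡ Y → 1ℤ · X + -1ℤ · Y ≡ 0ℤ
  +-1·-cancel {X} refl = cancel X
    where
    cancel : ∀ x → 1ℤ · x + -1ℤ · x ≡ 0ℤ
    cancel = solve-∀

  isolate : ∀ {s s′ c} → s + s′ ≡ c → s′ ≡ c - s
  isolate {s} {s′} refl = eq s s′
    where
    eq : ∀ s s′ → s′ ≡ s + s′ - s
    eq = solve-∀

module _ (K : ℕ) (a b : ℤ) (x : ℕ) where

  private
    ts = terms K

    -- What lowering b, respectively a, subtracts from each term. In `gˡ` the indices of `H` are
    -- exchanged so that the exponent again belongs to the second index, as `sh-H-swap` requires.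
    gʳ gˡ : Term → ℤ
    gʳ t = sgn t · sh (expo (root t)) (sh (abs (b + offset t)) (H (a - offset t) (b + offset t))) x
    gˡ t = sgn t · sh (expo (root t)) (sh (abs (a - offset t)) (H (b + offset t) (a - offset t))) x

    split : ∀ c y z → c · (y - z) ≡ c · y + - (c · z)
    split = solve-∀

    S-predʳ : S K a (b - 1ℤ) x ≡ S K a b x - ∑ ts gʳ
    S-predʳ = begin
      ∑ ts (λ t → sgn t · W a (b - 1ℤ) t x)               ≡⟨ ∑-cong ts (λ t → cong (sgn t ·_) (step t)) ⟩
      ∑ ts (λ t → sgn t · (W a b t x - z t))              ≡⟨ ∑-cong ts (λ t → split (sgn t) (W a b t x) (z t)) ⟩
      ∑ ts (λ t → sgn t · W a b t x + - gʳ t)             ≡⟨ ∑-+ ts (λ t → sgn t · W a b t x) (λ t → - gʳ t) ⟩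
      S K a b x + ∑ ts (λ t → - gʳ t)                     ≡⟨ cong (_+_ (S K a b x)) (∑-neg ts gʳ) ⟩
      S K a b x - ∑ ts gʳ                                 ∎
      where
      open ≡-Reasoning
      z : Term → ℤ
      z t = sh (expo (root t)) (sh (abs (b + offset t)) (H (a - offset t) (b + offset t))) x
      j-eq : ∀ b c → b - 1ℤ + c ≡ b + c - 1ℤ
      j-eq = solve-∀
      step : ∀ t → W a (b - 1ℤ) t x ≡ W a b t x - z t
      step t rewrite j-eq b (offset t) =
        trans (sh-cong e (H-predʳ i j) x)
        (trans (sh-lin e (H i j) (λ y → - sh (abs j) (H i j) y) x) (cong (_+_ (sh e (H i j) x)) (sh-neg e (sh (abs j) (H i j)) x)))
        where
        e = expo (root t)
        i = a - offset t
        j = b + offset t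

    S-predˡ : S K (a - 1ℤ) b x ≡ S K a b x - ∑ ts gˡ
    S-predˡ = begin
      ∑ ts (λ t → sgn t · W (a - 1ℤ) b t x)               ≡⟨ ∑-cong ts (λ t → cong (sgn t ·_) (step t)) ⟩
      ∑ ts (λ t → sgn t · (W a b t x - z t))              ≡⟨ ∑-cong ts (λ t → split (sgn t) (W a b t x) (z t)) ⟩
      ∑ ts (λ t → sgn t · W a b t x + - gˡ t)             ≡⟨ ∑-+ ts (λ t → sgn t · W a b t x) (λ t → - gˡ t) ⟩
      S K a b x + ∑ ts (λ t → - gˡ t)                     ≡⟨ cong (_+_ (S K a b x)) (∑-neg ts gˡ) ⟩
      S K a b x - ∑ ts gˡ                                 ∎
      where
      open ≡-Reasoning
      z : Term → ℤ
      z t = sh (expo (root t)) (sh (abs (a - offset t)) (H (b + offset t) (a - offset t))) x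
      i-eq : ∀ a c → a - 1ℤ - c ≡ a - c - 1ℤ
      i-eq = solve-∀
      step : ∀ t → W (a - 1ℤ) b t x ≡ W a b t x - z t
      step t rewrite i-eq a (offset t) =
        trans (sh-cong e (λ y → trans (H-comm (i - 1ℤ) j y) (H-predʳ j i y)) x)
        (trans (sh-lin e (H j i) (λ y → - sh (abs i) (H j i) y) x)
        (cong₂ _+_ (sh-cong e (H-comm j i) x) (sh-neg e (sh (abs i) (H j i)) x)))
        where
        e = expo (root t)
        i = a - offset t
        j = b + offset t

    leftover : ∀ t f → x < abs (root t) → sgn t · sh (expo (root t)) f x ≡ 0ℤ
    leftover t f x<r = trans (cong (sgn t ·_) (sh-< f (ℕₚ.<-≤-trans x<r (abs≤expo (root t))))) (ℤₚ.*-zeroʳ (sgn t))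

    minus-zero : ∀ {X Y Z} → X ≡ Y - Z → Z ≡ 0ℤ → X ≡ Y
    minus-zero {Y = Y} X≡ refl = trans X≡ (ℤₚ.+-identityʳ Y)

  -- Exchanging a-c and a+2+c is c ↦ -2-c, which pairs `even s` with `odd (-1-s)`. The unpaired term
  -- has root above K, hence exponent above x; this is where x ≤ K enters.
  S-boundary₁ : b ≡ a + + 2 → x ≤ K → S K a (b - 1ℤ) x ≡ S K a b x
  S-boundary₁ refl x≤K = minus-zero S-predʳ
    (trans (∑-terms-pair₁ gʳ pair K) (leftover (odd (+ K)) _ (ℕₚ.≤-<-trans x≤K (root-odd⁺-large K))))
    where
    i′-eq : ∀ a s → a - (+ 6 · (-1ℤ - s) + + 4) ≡ a + + 2 + + 6 · s
    i′-eq = solve-∀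
    j′-eq : ∀ a s → a + + 2 + (+ 6 · (-1ℤ - s) + + 4) ≡ a - + 6 · s
    j′-eq = solve-∀
    E-eq : ∀ a s → (- (+ 2 · s)) · (+ 3 · (- (+ 2 · s)) + 1ℤ) + (a + + 2 + + 6 · s)
                 ≡ (+ 2 · (-1ℤ - s) + 1ℤ) · (+ 3 · (+ 2 · (-1ℤ - s) + 1ℤ) + 1ℤ) + (a - + 6 · s)
    E-eq = solve-∀
    pair : ∀ s s′ → s + s′ ≡ -1ℤ → gʳ (even s) + gʳ (odd s′) ≡ 0ℤ
    pair s s′ s+s′ with refl ← isolate {s} s+s′ = +-1·-cancel
      (sh-H-swap (expo (root (even s))) (expo (root (odd s′))) (i′-eq a s) (j′-eq a s)
        (trans (cong (_+ (a + + 2 + + 6 · s)) (expo-pos (root (even s))))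
        (trans (E-eq a s) (cong (_+ (a - + 6 · s)) (sym (expo-pos (root (odd s′))))))) x)

  -- Exchanging b+4-c and b+c is c ↦ 4-c, which pairs `even s` with `odd (-s)`.
  S-boundary₂ : a ≡ b + + 4 → x ≤ K → S K (a - 1ℤ) b x ≡ S K a b x
  S-boundary₂ refl x≤K = minus-zero S-predˡ
    (trans (∑-terms-pair₂ gˡ pair K) (leftover (odd -[1+ K ]) _ (ℕₚ.≤-<-trans x≤K (root-odd⁻-large K))))
    where
    i′-eq : ∀ b s → b + (+ 6 · (0ℤ - s) + + 4) ≡ b + + 4 - + 6 · s
    i′-eq = solve-∀
    j′-eq : ∀ b s → b + + 4 - (+ 6 · (0ℤ - s) + + 4) ≡ b + + 6 · s
    j′-eq = solve-∀
    E-eq : ∀ b s → (- (+ 2 · s)) · (+ 3 · (- (+ 2 · s)) + 1ℤ) + (b + + 4 - + 6 · s)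
                 ≡ (+ 2 · (0ℤ - s) + 1ℤ) · (+ 3 · (+ 2 · (0ℤ - s) + 1ℤ) + 1ℤ) + (b + + 6 · s)
    E-eq = solve-∀
    pair : ∀ s s′ → s + s′ ≡ 0ℤ → gˡ (even s) + gˡ (odd s′) ≡ 0ℤ
    pair s s′ s+s′ with refl ← isolate {s} s+s′ = +-1·-cancel
      (sh-H-swap (expo (root (even s))) (expo (root (odd s′))) (i′-eq b s) (j′-eq b s)
        (trans (cong (_+ (b + + 4 - + 6 · s)) (expo-pos (root (even s))))
        (trans (E-eq b s) (cong (_+ (b + + 6 · s)) (sym (expo-pos (root (odd s′))))))) x)

-- For a ≤ 3 and b ≤ 1 only offset 0 survives: the positive offsets are at least 4 and make a-c
-- negative, the negative ones are at most -2 and make b+c negative. This covers the origin and the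
-- points with an index -1 that the recurrence reaches from the strip.
S-small : ∀ K u v x → S K (+ 3 - + u) (1ℤ - + v) x ≡ H (+ 3 - + u) (1ℤ - + v) x
S-small K u v x = go K
  where
  a = + 3 - + u
  b = 1ℤ - + v

  six : ∀ j → + 6 · + j ≡ + (6 * j)
  six j = sym (ℤₚ.pos-* 6 j)

  neg1+ : ∀ j → -[1+ j ] ≡ -1ℤ - + j
  neg1+ zero    = refl
  neg1+ (suc j) = refl

  sum : ∀ p q r → + (p ℕ.+ q ℕ.+ 6 * r) ≡ + p + + q + + 6 · + r
  sum p q r = cong (_+_ (+ p + + q)) (sym (six r))

  W-zeroˡ : ∀ t w → a - offset t ≡ -1ℤ - + w → sgn t · W a b t x ≡ 0ℤ
  W-zeroˡ t w eq = trans (cong (sgn t ·_) (sh-zero (expo (root t)) (H-zeroˡ (a - offset t) (b + offset t) (qPochInvℤ-neg w eq)) x)) (ℤₚ.*-zeroʳ (sgn t))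

  W-zeroʳ : ∀ t w → b + offset t ≡ -1ℤ - + w → sgn t · W a b t x ≡ 0ℤ
  W-zeroʳ t w eq = trans (cong (sgn t ·_) (sh-zero (expo (root t)) (H-zeroʳ (a - offset t) (b + offset t) (qPochInvℤ-neg w eq)) x)) (ℤₚ.*-zeroʳ (sgn t))

  P⁺ : ∀ j → sgn (even (+ suc j)) · W a b (even (+ suc j)) x ≡ 0ℤ
  P⁺ j = W-zeroˡ (even (+ suc j)) (2 ℕ.+ u ℕ.+ 6 * j) (trans (eq (+ u) (+ j)) (cong (λ z → -1ℤ - z) (sym (sum 2 u j))))
    where
    eq : ∀ u j → + 3 - u - + 6 · (1ℤ + j) ≡ -1ℤ - (+ 2 + u + + 6 · j)
    eq = solve-∀

  P⁻ : ∀ j → sgn (even -[1+ j ]) · W a b (even -[1+ j ]) x ≡ 0ℤ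
  P⁻ j = W-zeroʳ (even -[1+ j ]) (4 ℕ.+ v ℕ.+ 6 * j)
    (trans (cong (λ s → b + + 6 · s) (neg1+ j)) (trans (eq (+ v) (+ j)) (cong (λ z → -1ℤ - z) (sym (sum 4 v j)))))
    where
    eq : ∀ v j → 1ℤ - v + + 6 · (-1ℤ - j) ≡ -1ℤ - (+ 4 + v + + 6 · j)
    eq = solve-∀

  N⁺ : ∀ j → sgn (odd (+ j)) · W a b (odd (+ j)) x ≡ 0ℤ
  N⁺ j = W-zeroˡ (odd (+ j)) (0 ℕ.+ u ℕ.+ 6 * j) (trans (eq (+ u) (+ j)) (cong (λ z → -1ℤ - z) (sym (sum 0 u j))))
    where
    eq : ∀ u j → + 3 - u - (+ 6 · j + + 4) ≡ -1ℤ - (0ℤ + u + + 6 · j)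
    eq = solve-∀

  N⁻ : ∀ j → sgn (odd -[1+ j ]) · W a b (odd -[1+ j ]) x ≡ 0ℤ
  N⁻ j = W-zeroʳ (odd -[1+ j ]) (0 ℕ.+ v ℕ.+ 6 * j)
    (trans (cong (λ s → b + (+ 6 · s + + 4)) (neg1+ j)) (trans (eq (+ v) (+ j)) (cong (λ z → -1ℤ - z) (sym (sum 0 v j)))))
    where
    eq : ∀ v j → 1ℤ - v + (+ 6 · (-1ℤ - j) + + 4) ≡ -1ℤ - (0ℤ + v + + 6 · j)
    eq = solve-∀

  go : ∀ K → S K a b x ≡ H a b x
  go zero = trans (cong₂ (λ y z → 1ℤ · W a b (even 0ℤ) x + (y + (z + 0ℤ))) (N⁺ 0) (N⁻ 0))
    (trans (ℤₚ.+-identityʳ _) (trans (ℤₚ.*-identityˡ (H (a - 0ℤ) (b + 0ℤ) x))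
      (cong₂ (λ y z → H y z x) (ℤₚ.+-identityʳ a) (ℤₚ.+-identityʳ b))))
  go (suc K) = trans
    (cong₂ _+_ (P⁺ K) (cong₂ _+_ (P⁻ K) (cong₂ _+_ (N⁺ (suc K)) (cong₂ _+_ (N⁻ (suc K)) (go K)))))
    (zeros (H a b x))
    where
    zeros : ∀ y → 0ℤ + (0ℤ + (0ℤ + (0ℤ + y))) ≡ y
    zeros = solve-∀

-- Cylindric partitions

-- Unlike `isCyl31`, the conditions range over all indices, which spares range conditions when
-- indices are shifted. Past the end the smaller entry is 0, so nothing is added.
record Cyl (l₁ l₂ : Vec ℕ n) : Set where
  field
    dec₁  : ∀ i → nth l₁ (suc i) ≤ nth l₁ i
    dec₂  : ∀ i → nth l₂ (suc i) ≤ nth l₂ i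
    inter₁ : ∀ i → nth l₂ (suc i) ≤ nth l₁ i
    inter₂ : ∀ i → nth l₁ (3 ℕ.+ i) ≤ nth l₂ i

open Cyl

nth-beyond : (v : Vec ℕ n) → ∀ {i} → n ≤ i → nth v i ≡ 0
nth-beyond []      _         = refl
nth-beyond (x ∷ v) (s≤s n≤i) = nth-beyond v n≤i

isCyl31⇒Cyl : (l₁ l₂ : Vec ℕ n) → T (isCyl31 l₁ l₂) → Cyl l₁ l₂
isCyl31⇒Cyl {n} l₁ l₂ t = record
  { dec₁   = λ i → at l₁ 1 i (λ i<n → proj₁ (cond i<n))
  ; dec₂   = λ i → at l₂ 1 i (λ i<n → proj₁ (proj₂ (cond i<n)))
  ; inter₁ = λ i → at l₂ 1 i (λ i<n → subst (λ j → T (nth l₂ j ≤ᵇ nth l₁ i)) (ℕₚ.+-comm i 1) (proj₁ (proj₂ (proj₂ (cond i<n)))))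
  ; inter₂ = λ i → at l₁ 3 i (λ i<n → subst (λ j → T (nth l₁ j ≤ᵇ nth l₂ i)) (ℕₚ.+-comm i 3) (proj₂ (proj₂ (proj₂ (cond i<n)))))
  }
  where
  cond : ∀ {i} → i < n → T (nth l₁ (suc i) ≤ᵇ nth l₁ i) × T (nth l₂ (suc i) ≤ᵇ nth l₂ i)
                       × T (nth l₂ (i ℕ.+ 1) ≤ᵇ nth l₁ i) × T (nth l₁ (i ℕ.+ 3) ≤ᵇ nth l₂ i)
  cond i<n with Equivalence.to T-∧ (applyUpTo⁻ id n (all⁺ _ (upTo n) t) i<n)
  ... | p , q with Equivalence.to T-∧ q
  ... | r , s = p , r , Equivalence.to T-∧ s

  at : ∀ (v : Vec ℕ n) d i {y} → (i < n → T (nth v (d ℕ.+ i) ≤ᵇ y)) → nth v (d ℕ.+ i) ≤ y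
  at v d i h with ℕₚ.<-≤-connex i n
  ... | inj₁ i<n = ℕₚ.≤ᵇ⇒≤ _ _ (h i<n)
  ... | inj₂ n≤i rewrite nth-beyond v (ℕₚ.≤-trans n≤i (ℕₚ.m≤n+m i d)) = z≤n

Cyl⇒isCyl31 : (l₁ l₂ : Vec ℕ n) → Cyl l₁ l₂ → T (isCyl31 l₁ l₂)
Cyl⇒isCyl31 {n} l₁ l₂ c = all⁻ _ (applyUpTo⁺₁ id n λ {i} _ →
  Equivalence.from T-∧ (ℕₚ.≤⇒≤ᵇ (dec₁ c i) ,
  Equivalence.from T-∧ (ℕₚ.≤⇒≤ᵇ (dec₂ c i) ,
  Equivalence.from T-∧
    ( ℕₚ.≤⇒≤ᵇ (subst (λ j → nth l₂ j ≤ nth l₁ i) (ℕₚ.+-comm 1 i) (inter₁ c i))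
    , ℕₚ.≤⇒≤ᵇ (subst (λ j → nth l₁ j ≤ nth l₂ i) (ℕₚ.+-comm 3 i) (inter₂ c i))))))

nth-antitone : (v : Vec ℕ n) → (∀ i → nth v (suc i) ≤ nth v i) → ∀ {i j} → i ≤ j → nth v j ≤ nth v i
nth-antitone v dec {i} i≤j with ℕₚ.m≤n⇒∃[o]m+o≡n i≤j
... | o , refl = go o
  where
  go : ∀ o → nth v (i ℕ.+ o) ≤ nth v i
  go zero    rewrite ℕₚ.+-identityʳ i = ℕₚ.≤-refl
  go (suc o) rewrite ℕₚ.+-suc i o = ℕₚ.≤-trans (dec (i ℕ.+ o)) (go o)

nth≤sumV : (v : Vec ℕ n) → ∀ i → nth v i ≤ sumV v
nth≤sumV []      i       = z≤n
nth≤sumV (x ∷ v) zero    = ℕₚ.m≤m+n x (sumV v)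
nth≤sumV (x ∷ v) (suc i) = ℕₚ.≤-trans (nth≤sumV v i) (ℕₚ.m≤n+m (sumV v) x)

-- Adding one to the first a entries

bump : ℕ → Vec ℕ n → Vec ℕ n
bump zero    v       = v
bump (suc a) []      = []
bump (suc a) (x ∷ v) = suc x ∷ bump a v

below : ℕ → ℕ → ℕ
below zero    _       = 0
below (suc a) zero    = 1
below (suc a) (suc i) = below a i

nth-bump : ∀ {a} (v : Vec ℕ n) → a ≤ n → ∀ i → nth (bump a v) i ≡ below a i ℕ.+ nth v i
nth-bump {a = zero}  v       _         i       = refl
nth-bump {a = suc a} (x ∷ v) (s≤s a≤n) zero    = refl
nth-bump {a = suc a} (x ∷ v) (s≤s a≤n) (suc i) = nth-bump v a≤n i

sumV-bump : ∀ {a} (v : Vec ℕ n) → a ≤ n → sumV (bump a v) ≡ a ℕ.+ sumV v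
sumV-bump {a = zero}  v       _         = refl
sumV-bump {a = suc a} (x ∷ v) (s≤s a≤n) = cong suc (trans (cong (x ℕ.+_) (sumV-bump v a≤n))
  (trans (sym (ℕₚ.+-assoc x a (sumV v))) (trans (cong (ℕ._+ sumV v) (ℕₚ.+-comm x a)) (ℕₚ.+-assoc a x (sumV v)))))

below-< : ∀ {a i} → i < a → below a i ≡ 1
below-< {suc a} {zero}  _         = refl
below-< {suc a} {suc i} (s≤s i<a) = below-< i<a

below-≥ : ∀ {a i} → a ≤ i → below a i ≡ 0
below-≥ {zero}          _         = refl
below-≥ {suc a} {suc i} (s≤s a≤i) = below-≥ a≤i

below-mono : ∀ {a b i j} → (j < b → i < a) → below b j ≤ below a i
below-mono {a} {b} {i} {j} imp with ℕₚ.<-≤-connex j b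
... | inj₁ j<b rewrite below-< j<b | below-< (imp j<b) = ℕₚ.≤-refl
... | inj₂ b≤j rewrite below-≥ b≤j = z≤n

-- An inequality survives if a raised smaller entry always faces a raised larger one. For the two
-- interlacing conditions this means b ≤ 1+a and a ≤ 3+b.
≤-bump : ∀ {a b} (u v : Vec ℕ n) → a ≤ n → b ≤ n → ∀ i j → (j < b → i < a) →
  nth v j ≤ nth u i → nth (bump b v) j ≤ nth (bump a u) i
≤-bump u v a≤n b≤n i j imp le rewrite nth-bump u a≤n i | nth-bump v b≤n j = ℕₚ.+-mono-≤ (below-mono imp) le

-- At j ≥ b the larger entry may have been raised alone, so the smaller one has to be known to be 0.
≤-unbump : ∀ {a b} (u v : Vec ℕ n) → a ≤ n → b ≤ n → ∀ i j → (j < b → i < a) → (b ≤ j → nth v j ≡ 0) →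
  nth (bump b v) j ≤ nth (bump a u) i → nth v j ≤ nth u i
≤-unbump {b = b} u v a≤n b≤n i j imp zeros le with ℕₚ.<-≤-connex j b
... | inj₂ b≤j rewrite zeros b≤j = z≤n
... | inj₁ j<b rewrite nth-bump u a≤n i | nth-bump v b≤n j | below-< j<b | below-< (imp j<b) = ℕ.s≤s⁻¹ le

module _ {a b} (l₁ l₂ : Vec ℕ n) (a≤n : a ≤ n) (b≤n : b ≤ n) (b≤1+a : b ≤ 1 ℕ.+ a) (a≤3+b : a ≤ 3 ℕ.+ b) where

  private
    step : ∀ {c i} → suc i < c → i < c
    step = ℕₚ.<-trans (ℕₚ.n<1+n _)

    imp₁ : ∀ {i} → suc i < b → i < a
    imp₁ lt = ℕ.s≤s⁻¹ (ℕₚ.≤-trans lt b≤1+a)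

    imp₂ : ∀ {i} → 3 ℕ.+ i < a → i < b
    imp₂ lt = ℕ.s≤s⁻¹ (ℕ.s≤s⁻¹ (ℕ.s≤s⁻¹ (ℕₚ.≤-trans lt a≤3+b)))

  Cyl-bump : Cyl l₁ l₂ → Cyl (bump a l₁) (bump b l₂)
  Cyl-bump c = record
    { dec₁   = λ i → ≤-bump l₁ l₁ a≤n a≤n i _ step (dec₁ c i)
    ; dec₂   = λ i → ≤-bump l₂ l₂ b≤n b≤n i _ step (dec₂ c i)
    ; inter₁ = λ i → ≤-bump l₁ l₂ a≤n b≤n i _ imp₁ (inter₁ c i)
    ; inter₂ = λ i → ≤-bump l₂ l₁ b≤n a≤n i _ imp₂ (inter₂ c i)
    }

  Cyl-unbump : nth l₁ a ≡ 0 → nth l₂ b ≡ 0 → Cyl (bump a l₁) (bump b l₂) → Cyl l₁ l₂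
  Cyl-unbump l₁a≡0 l₂b≡0 c = record
    { dec₁   = λ i → ≤-unbump l₁ l₁ a≤n a≤n i _ step z₁ (dec₁ c i)
    ; dec₂   = λ i → ≤-unbump l₂ l₂ b≤n b≤n i _ step z₂ (dec₂ c i)
    ; inter₁ = λ i → ≤-unbump l₁ l₂ a≤n b≤n i _ imp₁ z₂ (inter₁ c i)
    ; inter₂ = λ i → ≤-unbump l₂ l₁ b≤n a≤n i _ imp₂ z₁ (inter₂ c i)
    }
    where
    -- `v` is not yet known to decrease, but from index c on it coincides with `bump c v`, which
    -- does.
    tail-zero : ∀ {c} (v : Vec ℕ n) → c ≤ n → nth v c ≡ 0 → (∀ i → nth (bump c v) (suc i) ≤ nth (bump c v) i) →
      ∀ {j} → c ≤ j → nth v j ≡ 0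
    tail-zero {c} v c≤n vc≡0 dec {j} c≤j with nth-antitone (bump c v) dec c≤j
    ... | le rewrite nth-bump v c≤n j | nth-bump v c≤n c | below-≥ c≤j | below-≥ (ℕₚ.≤-refl {c}) | vc≡0 = ℕₚ.n≤0⇒n≡0 le

    z₁ : ∀ {j} → a ≤ j → nth l₁ j ≡ 0
    z₁ = tail-zero l₁ a≤n l₁a≡0 (dec₁ c)

    z₂ : ∀ {j} → b ≤ j → nth l₂ j ≡ 0
    z₂ = tail-zero l₂ b≤n l₂b≡0 (dec₂ c)

  isCyl31-bump : nth l₁ a ≡ 0 → nth l₂ b ≡ 0 → isCyl31 (bump a l₁) (bump b l₂) ≡ isCyl31 l₁ l₂
  isCyl31-bump l₁a≡0 l₂b≡0 = ⇔→≡ (mk⇔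
    (λ eq → Equivalence.to T-≡ (Cyl⇒isCyl31 l₁ l₂ (Cyl-unbump l₁a≡0 l₂b≡0 (isCyl31⇒Cyl (bump a l₁) (bump b l₂) (Equivalence.from T-≡ eq)))))
    (λ eq → Equivalence.to T-≡ (Cyl⇒isCyl31 (bump a l₁) (bump b l₂) (Cyl-bump (isCyl31⇒Cyl l₁ l₂ (Equivalence.from T-≡ eq))))))

-- Sums over boxes of vectors

∑-upTo-shift : ∀ B (g : ℕ → ℤ) → g 0 ≡ 0ℤ → g (suc B) ≡ 0ℤ → ∑ (upTo (suc B)) g ≡ ∑ (upTo (suc B)) (g ∘ suc)
∑-upTo-shift B g g0 gB = begin
  ∑ (upTo (suc B)) g                  ≡⟨ ∑-upTo-suc B g ⟩
  g 0 + ∑ (upTo B) (g ∘ suc)          ≡⟨ cong (_+ ∑ (upTo B) (g ∘ suc)) g0 ⟩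
  0ℤ + ∑ (upTo B) (g ∘ suc)           ≡⟨ ℤₚ.+-comm 0ℤ (∑ (upTo B) (g ∘ suc)) ⟩
  ∑ (upTo B) (g ∘ suc) + 0ℤ           ≡⟨ cong (_+_ (∑ (upTo B) (g ∘ suc))) gB ⟨
  ∑ (upTo B) (g ∘ suc) + g (suc B)    ≡⟨ ∑-upTo-last B (g ∘ suc) ⟨
  ∑ (upTo (suc B)) (g ∘ suc)          ∎
  where open ≡-Reasoning

∑-vecs-suc : ∀ n B (f : Vec ℕ (suc n) → ℤ) →
  ∑ (vecsUpTo (suc n) B) f ≡ ∑ (upTo (suc B)) (λ x → ∑ (vecsUpTo n B) (λ v → f (x ∷ v)))
∑-vecs-suc n B f = trans (∑-concatMap (λ x → map (x ∷_) (vecsUpTo n B)) (upTo (suc B)) f)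
  (∑-cong (upTo (suc B)) (λ x → ∑-map (x ∷_) (vecsUpTo n B) f))

-- Bumping moves the range 0..B of the first a coordinates to 1..B+1. The two hypotheses make `f`
-- vanish at the entries 0 that are lost and the entries B+1 that are gained.
∑-vecs-bump : ∀ n B a (f : Vec ℕ n → ℤ) → a ≤ n →
  (∀ v i → i < a → nth v i ≡ 0 → f v ≡ 0ℤ) →
  (∀ v i → B < nth v i → f v ≡ 0ℤ) →
  ∑ (vecsUpTo n B) f ≡ ∑ (vecsUpTo n B) (f ∘ bump a)
∑-vecs-bump n       B zero    f _         _     _     = refl
∑-vecs-bump (suc n) B (suc a) f (s≤s a≤n) zeros large = begin
  ∑ (vecsUpTo (suc n) B) f
    ≡⟨ ∑-vecs-suc n B f ⟩
  ∑ (upTo (suc B)) (λ x → ∑ (vecsUpTo n B) (λ v → f (x ∷ v)))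
    ≡⟨ ∑-upTo-shift B (λ x → ∑ (vecsUpTo n B) (λ v → f (x ∷ v)))
         (∑-zero (vecsUpTo n B) (λ v → zeros (0 ∷ v) 0 (s≤s z≤n) refl))
         (∑-zero (vecsUpTo n B) (λ v → large (suc B ∷ v) 0 ℕₚ.≤-refl)) ⟩
  ∑ (upTo (suc B)) (λ x → ∑ (vecsUpTo n B) (λ v → f (suc x ∷ v)))
    ≡⟨ ∑-cong (upTo (suc B)) (λ x → ∑-vecs-bump n B a (λ v → f (suc x ∷ v)) a≤n
         (λ v i i<a → zeros (suc x ∷ v) (suc i) (s≤s i<a))
         (λ v i → large (suc x ∷ v) (suc i))) ⟩
  ∑ (upTo (suc B)) (λ x → ∑ (vecsUpTo n B) (λ v → f (suc x ∷ bump a v)))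
    ≡⟨ ∑-vecs-suc n B (f ∘ bump (suc a)) ⟨
  ∑ (vecsUpTo (suc n) B) (f ∘ bump (suc a)) ∎
  where open ≡-Reasoning

∑-vecs-replicate : ∀ n B (f : Vec ℕ n → ℤ) → (∀ v i {m} → nth v i ≡ suc m → f v ≡ 0ℤ) →
  ∑ (vecsUpTo n B) f ≡ f (replicate n 0)
∑-vecs-replicate zero    B f _    = ℤₚ.+-identityʳ (f [])
∑-vecs-replicate (suc n) B f zeros = begin
  ∑ (vecsUpTo (suc n) B) f
    ≡⟨ ∑-vecs-suc n B f ⟩
  ∑ (upTo (suc B)) (λ x → ∑ (vecsUpTo n B) (λ v → f (x ∷ v)))
    ≡⟨ ∑-upTo-suc B (λ x → ∑ (vecsUpTo n B) (λ v → f (x ∷ v))) ⟩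
  ∑ (vecsUpTo n B) (λ v → f (0 ∷ v)) + ∑ (upTo B) (λ x → ∑ (vecsUpTo n B) (λ v → f (suc x ∷ v)))
    ≡⟨ cong₂ _+_ (∑-vecs-replicate n B (λ v → f (0 ∷ v)) (λ v i → zeros (0 ∷ v) (suc i)))
         (∑-zero (upTo B) (λ x → ∑-zero (vecsUpTo n B) (λ v → zeros (suc x ∷ v) 0 refl))) ⟩
  f (replicate (suc n) 0) + 0ℤ
    ≡⟨ ℤₚ.+-identityʳ _ ⟩
  f (replicate (suc n) 0) ∎
  where open ≡-Reasoning

-- Counting by support

isZero : ℕ → ℤ
isZero zero    = 1ℤ
isZero (suc _) = 0ℤ

-- On a decreasing vector this indicates that the first a entries are all positive; testing the last
-- of them is enough.
full : ℕ → Vec ℕ n → ℤ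
full zero    v = 1ℤ
full (suc a) v = 1ℤ - isZero (nth v a)

sizeIs : ℕ → Vec ℕ n → Vec ℕ n → ℤ
sizeIs k l₁ l₂ = ι (sumV l₁ ℕ.+ sumV l₂ ≡ᵇ k)

-- w⁺ a b restricts w a b to pairs whose partitions have exactly a and b positive parts.
w w⁺ : ℕ → ℕ → ℕ → Vec ℕ n → Vec ℕ n → ℤ
w  a b k l₁ l₂ = ι (isCyl31 l₁ l₂) · (isZero (nth l₁ a) · isZero (nth l₂ b) · sizeIs k l₁ l₂)
w⁺ a b k l₁ l₂ = ι (isCyl31 l₁ l₂) · (isZero (nth l₁ a) · full a l₁ · (isZero (nth l₂ b) · full b l₂) · sizeIs k l₁ l₂)

ι-cong : ∀ b {X Y} → (T b → X ≡ Y) → ι b · X ≡ ι b · Y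
ι-cong true  X≡Y = cong (1ℤ ·_) (X≡Y _)
ι-cong false X≡Y = refl

ι-zero : ∀ b {X} → (T b → X ≡ 0ℤ) → ι b · X ≡ 0ℤ
ι-zero b X≡0 = trans (ι-cong b X≡0) (ℤₚ.*-zeroʳ (ι b))

-- For consecutive parts y ≤ x: at most a+1 parts means either at most a or exactly a+1.
isZero-split : ∀ {x y} → y ≤ x → isZero y ≡ isZero x + isZero y · (1ℤ - isZero x)
isZero-split {zero}  z≤n = refl
isZero-split {suc x} {zero}  _ = refl
isZero-split {suc x} {suc y} _ = refl

-- Inclusion-exclusion on whether the last admissible part of each partition vanishes; the remaining
-- case, where neither does, is `w⁺`.
w-rec : ∀ a b k (l₁ l₂ : Vec ℕ n) → w (suc a) (suc b) k l₁ l₂ ≡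
  w a (suc b) k l₁ l₂ + w (suc a) b k l₁ l₂ - w a b k l₁ l₂ + w⁺ (suc a) (suc b) k l₁ l₂
w-rec a b k l₁ l₂ = trans (ι-cong (isCyl31 l₁ l₂) λ t →
    let c = isCyl31⇒Cyl l₁ l₂ t in
    expand (isZero x) p (isZero x′) q (isZero-split (dec₁ c a)) (isZero-split (dec₂ c b)))
  (distr (ι (isCyl31 l₁ l₂)) (isZero x · isZero y′ · d) (isZero y · isZero x′ · d) (isZero x · isZero x′ · d) (p · q · d))
  where
  x = nth l₁ a
  y = nth l₁ (suc a)
  x′ = nth l₂ b
  y′ = nth l₂ (suc b)
  p = isZero y · (1ℤ - isZero x)
  q = isZero y′ · (1ℤ - isZero x′)
  d = sizeIs k l₁ l₂
  incl-excl : ∀ x x′ p q d → (x + p) · (x′ + q) · d ≡ x · (x′ + q) · d + (x + p) · x′ · d - x · x′ · d + p · q · d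
  incl-excl = solve-∀
  distr : ∀ c p q r s → c · (p + q - r + s) ≡ c · p + c · q - c · r + c · s
  distr = solve-∀
  expand : ∀ x {y} p x′ {y′} q → y ≡ x + p → y′ ≡ x′ + q →
    y · y′ · d ≡ x · y′ · d + y · x′ · d - x · x′ · d + p · q · d
  expand x p x′ q refl refl = incl-excl x x′ p q d

w-recˡ : ∀ a k (l₁ l₂ : Vec ℕ n) → w (suc a) 0 k l₁ l₂ ≡ w a 0 k l₁ l₂ + w⁺ (suc a) 0 k l₁ l₂
w-recˡ a k l₁ l₂ = trans (ι-cong (isCyl31 l₁ l₂) λ t →
    expand (isZero (nth l₁ a)) (isZero (nth l₁ (suc a)) · (1ℤ - isZero (nth l₁ a))) (isZero-split (dec₁ (isCyl31⇒Cyl l₁ l₂ t) a)))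
  (ℤₚ.*-distribˡ-+ (ι (isCyl31 l₁ l₂)) (isZero (nth l₁ a) · y′ · d) (isZero (nth l₁ (suc a)) · (1ℤ - isZero (nth l₁ a)) · (y′ · 1ℤ) · d))
  where
  d = sizeIs k l₁ l₂
  y′ = isZero (nth l₂ 0)
  distr : ∀ x p y′ d → (x + p) · y′ · d ≡ x · y′ · d + p · (y′ · 1ℤ) · d
  distr = solve-∀
  expand : ∀ x {y} p → y ≡ x + p → y · y′ · d ≡ x · y′ · d + p · (y′ · 1ℤ) · d
  expand x p refl = distr x p y′ d

w-recʳ : ∀ b k (l₁ l₂ : Vec ℕ n) → w 0 (suc b) k l₁ l₂ ≡ w 0 b k l₁ l₂ + w⁺ 0 (suc b) k l₁ l₂
w-recʳ b k l₁ l₂ = trans (ι-cong (isCyl31 l₁ l₂) λ t →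
    expand (isZero (nth l₂ b)) (isZero (nth l₂ (suc b)) · (1ℤ - isZero (nth l₂ b))) (isZero-split (dec₂ (isCyl31⇒Cyl l₁ l₂ t) b)))
  (ℤₚ.*-distribˡ-+ (ι (isCyl31 l₁ l₂)) (y · isZero (nth l₂ b) · d) (y · 1ℤ · (isZero (nth l₂ (suc b)) · (1ℤ - isZero (nth l₂ b))) · d))
  where
  d = sizeIs k l₁ l₂
  y = isZero (nth l₁ 0)
  distr : ∀ x p y d → y · (x + p) · d ≡ y · x · d + y · 1ℤ · p · d
  distr = solve-∀
  expand : ∀ x {y′} p → y′ ≡ x + p → y · y′ · d ≡ y · x · d + y · 1ℤ · p · d
  expand x p refl = distr x p y d

isZero·isZero-cong : ∀ {x y y′} → (x ≡ 0 → y ≡ 0) → (x ≡ 0 → y′ ≡ 0) → isZero x · isZero y ≡ isZero x · isZero y′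
isZero·isZero-cong {zero}  f g rewrite f refl | g refl = refl
isZero·isZero-cong {suc x} f g = refl

-- If the first partition has at most m parts, interlacing already limits the second to m+1, so both
-- bounds on it are automatic.
w-boundary₁ : ∀ m k (l₁ l₂ : Vec ℕ n) → w m (2 ℕ.+ m) k l₁ l₂ ≡ w m (1 ℕ.+ m) k l₁ l₂
w-boundary₁ m k l₁ l₂ = ι-cong (isCyl31 l₁ l₂) λ t →
  let c = isCyl31⇒Cyl l₁ l₂ t
      zero₁ : nth l₁ m ≡ 0 → nth l₂ (1 ℕ.+ m) ≡ 0
      zero₁ eq = ℕₚ.n≤0⇒n≡0 (subst (nth l₂ (1 ℕ.+ m) ≤_) eq (inter₁ c m))
  in cong (_· sizeIs k l₁ l₂) (isZero·isZero-cong
       (λ eq → ℕₚ.n≤0⇒n≡0 (subst (nth l₂ (2 ℕ.+ m) ≤_) (zero₁ eq) (dec₂ c (1 ℕ.+ m)))) zero₁)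

-- Likewise at most m parts in the second partition leave at most m+3 in the first.
w-boundary₂ : ∀ m k (l₁ l₂ : Vec ℕ n) → w (4 ℕ.+ m) m k l₁ l₂ ≡ w (3 ℕ.+ m) m k l₁ l₂
w-boundary₂ m k l₁ l₂ = ι-cong (isCyl31 l₁ l₂) λ t →
  let c = isCyl31⇒Cyl l₁ l₂ t
      zero₁ : nth l₂ m ≡ 0 → nth l₁ (3 ℕ.+ m) ≡ 0
      zero₁ eq = ℕₚ.n≤0⇒n≡0 (subst (nth l₁ (3 ℕ.+ m) ≤_) eq (inter₂ c m))
  in cong (_· sizeIs k l₁ l₂) (trans (ℤₚ.*-comm (isZero (nth l₁ (4 ℕ.+ m))) _) (trans (isZero·isZero-cong
       (λ eq → ℕₚ.n≤0⇒n≡0 (subst (nth l₁ (4 ℕ.+ m) ≤_) (zero₁ eq) (dec₁ c (3 ℕ.+ m)))) zero₁)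
       (ℤₚ.*-comm (isZero (nth l₂ m)) _)))

full-zero : ∀ {a} (v : Vec ℕ n) → (∀ i → nth v (suc i) ≤ nth v i) → ∀ {i} → i < a → nth v i ≡ 0 → full a v ≡ 0ℤ
full-zero {a = suc a} v dec (s≤s i≤a) vi≡0
  rewrite ℕₚ.n≤0⇒n≡0 (subst (nth v a ≤_) vi≡0 (nth-antitone v dec i≤a)) = refl

w⁺-zero₁ : ∀ a b k (l₁ l₂ : Vec ℕ n) {i} → i < a → nth l₁ i ≡ 0 → w⁺ a b k l₁ l₂ ≡ 0ℤ
w⁺-zero₁ a b k l₁ l₂ i<a eq = ι-zero (isCyl31 l₁ l₂) λ t →
  trans (cong (λ f → isZero (nth l₁ a) · f · _ · _) (full-zero l₁ (dec₁ (isCyl31⇒Cyl l₁ l₂ t)) i<a eq))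
        (zeros (isZero (nth l₁ a)) (isZero (nth l₂ b) · full b l₂) (sizeIs k l₁ l₂))
  where
  zeros : ∀ p q r → p · 0ℤ · q · r ≡ 0ℤ
  zeros = solve-∀

w⁺-zero₂ : ∀ a b k (l₁ l₂ : Vec ℕ n) {i} → i < b → nth l₂ i ≡ 0 → w⁺ a b k l₁ l₂ ≡ 0ℤ
w⁺-zero₂ a b k l₁ l₂ i<b eq = ι-zero (isCyl31 l₁ l₂) λ t →
  trans (cong (λ f → isZero (nth l₁ a) · full a l₁ · (isZero (nth l₂ b) · f) · _) (full-zero l₂ (dec₂ (isCyl31⇒Cyl l₁ l₂ t)) i<b eq))
        (zeros (isZero (nth l₁ a) · full a l₁) (isZero (nth l₂ b)) (sizeIs k l₁ l₂))
  where
  zeros : ∀ p q r → p · (q · 0ℤ) · r ≡ 0ℤ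
  zeros = solve-∀

≡ᵇ-> : ∀ {m k} → k < m → (m ≡ᵇ k) ≡ false
≡ᵇ-> {suc m} {zero}  _         = refl
≡ᵇ-> {suc m} {suc k} (s≤s k<m) = ≡ᵇ-> k<m

w⁺-large : ∀ a b k (l₁ l₂ : Vec ℕ n) → k < sumV l₁ ℕ.+ sumV l₂ → w⁺ a b k l₁ l₂ ≡ 0ℤ
w⁺-large a b k l₁ l₂ k< rewrite ≡ᵇ-> k< = zeros (ι (isCyl31 l₁ l₂)) (isZero (nth l₁ a) · full a l₁ · (isZero (nth l₂ b) · full b l₂))
  where
  zeros : ∀ p q → p · (q · 0ℤ) ≡ 0ℤ
  zeros = solve-∀

ι-≡ᵇ-sh : ∀ N s k → ι (N ℕ.+ s ≡ᵇ k) ≡ sh N (λ k′ → ι (s ≡ᵇ k′)) k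
ι-≡ᵇ-sh zero    s k       = refl
ι-≡ᵇ-sh (suc N) s zero    = refl
ι-≡ᵇ-sh (suc N) s (suc k) = ι-≡ᵇ-sh N s k

full-bump : ∀ {a} (v : Vec ℕ n) → a ≤ n → full a (bump a v) ≡ 1ℤ
full-bump {a = zero}  v _   = refl
full-bump {a = suc a} v a<n rewrite nth-bump v a<n a | below-< (ℕₚ.n<1+n a) = refl

nth-bump-self : ∀ {a} (v : Vec ℕ n) → a ≤ n → nth (bump a v) a ≡ nth v a
nth-bump-self {a = a} v a≤n rewrite nth-bump v a≤n a | below-≥ (ℕₚ.≤-refl {a}) = refl

-- Adding 1 to the first a and first b entries turns at most a and b parts into exactly a and b
-- positive ones and raises the size by a+b, which gives the factor q^(a+b).
w⁺-bump : ∀ {a b} k (l₁ l₂ : Vec ℕ n) → a ≤ n → b ≤ n → b ≤ 1 ℕ.+ a → a ≤ 3 ℕ.+ b →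
  w⁺ a b k (bump a l₁) (bump b l₂) ≡ sh (a ℕ.+ b) (λ k′ → w a b k′ l₁ l₂) k
w⁺-bump {a = a} {b} k l₁ l₂ a≤n b≤n b≤ a≤
  rewrite full-bump l₁ a≤n | full-bump l₂ b≤n | nth-bump-self l₁ a≤n | nth-bump-self l₂ b≤n
        | sumV-bump l₁ a≤n | sumV-bump l₂ b≤n = begin
  ι C′ · (isZero x · 1ℤ · (isZero y · 1ℤ) · ι (a ℕ.+ s₁ ℕ.+ (b ℕ.+ s₂) ≡ᵇ k))
    ≡⟨ cong₂ (λ p q → ι C′ · (p · ι (q ≡ᵇ k))) (ones (isZero x) (isZero y)) (ℕ-interchange a s₁ b s₂) ⟩
  ι C′ · (isZero x · isZero y · ι (a ℕ.+ b ℕ.+ (s₁ ℕ.+ s₂) ≡ᵇ k))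
    ≡⟨ same-cyl x y refl refl ⟩
  ι C · (isZero x · isZero y · ι (a ℕ.+ b ℕ.+ (s₁ ℕ.+ s₂) ≡ᵇ k))
    ≡⟨ cong (λ d → ι C · (isZero x · isZero y · d)) (ι-≡ᵇ-sh (a ℕ.+ b) (s₁ ℕ.+ s₂) k) ⟩
  ι C · (isZero x · isZero y · sh (a ℕ.+ b) (λ k′ → sizeIs k′ l₁ l₂) k)
    ≡⟨ cong (ι C ·_) (sh-·ˡ (a ℕ.+ b) (isZero x · isZero y) (λ k′ → sizeIs k′ l₁ l₂) k) ⟨
  ι C · sh (a ℕ.+ b) (λ k′ → isZero x · isZero y · sizeIs k′ l₁ l₂) k
    ≡⟨ sh-·ˡ (a ℕ.+ b) (ι C) (λ k′ → isZero x · isZero y · sizeIs k′ l₁ l₂) k ⟨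
  sh (a ℕ.+ b) (λ k′ → w a b k′ l₁ l₂) k ∎
  where
  open ≡-Reasoning
  x = nth l₁ a
  y = nth l₂ b
  s₁ = sumV l₁
  s₂ = sumV l₂
  C = isCyl31 l₁ l₂
  C′ = isCyl31 (bump a l₁) (bump b l₂)

  ones : ∀ p q → p · 1ℤ · (q · 1ℤ) ≡ p · q
  ones = solve-∀

  ℕ-interchange : ∀ p q r s → p ℕ.+ q ℕ.+ (r ℕ.+ s) ≡ p ℕ.+ r ℕ.+ (q ℕ.+ s)
  ℕ-interchange p q r s = ℤₚ.+-injective (interchange (+ p) (+ q) (+ r) (+ s))

  -- The two cylindricity tests are known to agree only if both vectors vanish at their cut-offs;
  -- otherwise an `isZero` factor kills both sides.
  same-cyl : ∀ x′ y′ {D} → x′ ≡ x → y′ ≡ y → ι C′ · (isZero x′ · isZero y′ · D) ≡ ι C · (isZero x′ · isZero y′ · D)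
  same-cyl zero zero {D} x≡ y≡ = cong (λ c → ι c · (1ℤ · D)) (isCyl31-bump l₁ l₂ a≤n b≤n b≤ a≤ (sym x≡) (sym y≡))
  same-cyl zero (suc _) {D} _ _ = trans (ℤₚ.*-zeroʳ (ι C′)) (sym (ℤₚ.*-zeroʳ (ι C)))
  same-cyl (suc _) y′   {D} _ _ = trans (ℤₚ.*-zeroʳ (ι C′)) (sym (ℤₚ.*-zeroʳ (ι C)))

module Count (n B : ℕ) where

  private
    vs = vecsUpTo n B

  ∑∑ : (Vec ℕ n → Vec ℕ n → ℤ) → ℤ
  ∑∑ f = ∑ vs (λ l₁ → ∑ vs (f l₁))

  ∑∑-cong : ∀ {f g} → (∀ l₁ l₂ → f l₁ l₂ ≡ g l₁ l₂) → ∑∑ f ≡ ∑∑ g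
  ∑∑-cong f≡g = ∑-cong vs (λ l₁ → ∑-cong vs (f≡g l₁))

  ∑∑-+ : ∀ f g → ∑∑ (λ l₁ l₂ → f l₁ l₂ + g l₁ l₂) ≡ ∑∑ f + ∑∑ g
  ∑∑-+ f g = trans (∑-cong vs (λ l₁ → ∑-+ vs (f l₁) (g l₁))) (∑-+ vs (λ l₁ → ∑ vs (f l₁)) (λ l₁ → ∑ vs (g l₁)))

  ∑∑-neg : ∀ f → ∑∑ (λ l₁ l₂ → - f l₁ l₂) ≡ - ∑∑ f
  ∑∑-neg f = trans (∑-cong vs (λ l₁ → ∑-neg vs (f l₁))) (∑-neg vs (λ l₁ → ∑ vs (f l₁)))

  -- The box bound B is independent of k because the recurrence compares different degrees; for k ≤
  -- B no partition is missed.
  F : ℕ → ℕ → Series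
  F a b k = ∑∑ (w a b k)

  ∑∑-w⁺ : ∀ {a b k} → a ≤ n → b ≤ n → b ≤ 1 ℕ.+ a → a ≤ 3 ℕ.+ b → k ≤ B →
    ∑∑ (w⁺ a b k) ≡ sh (a ℕ.+ b) (F a b) k
  ∑∑-w⁺ {a} {b} {k} a≤n b≤n b≤ a≤ k≤B = begin
    ∑∑ (w⁺ a b k)
      ≡⟨ ∑-cong vs (λ l₁ → ∑-vecs-bump n B b (w⁺ a b k l₁) b≤n
           (λ l₂ i → w⁺-zero₂ a b k l₁ l₂)
           (λ l₂ i B< → w⁺-large a b k l₁ l₂ (ℕₚ.<-≤-trans (ℕₚ.≤-<-trans k≤B B<)
             (ℕₚ.≤-trans (nth≤sumV l₂ i) (ℕₚ.m≤n+m _ (sumV l₁)))))) ⟩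
    ∑ vs (λ l₁ → ∑ vs (λ l₂ → w⁺ a b k l₁ (bump b l₂)))
      ≡⟨ ∑-vecs-bump n B a (λ l₁ → ∑ vs (λ l₂ → w⁺ a b k l₁ (bump b l₂))) a≤n
           (λ l₁ i i<a eq → ∑-zero vs (λ l₂ → w⁺-zero₁ a b k l₁ (bump b l₂) i<a eq))
           (λ l₁ i B< → ∑-zero vs (λ l₂ → w⁺-large a b k l₁ (bump b l₂) (ℕₚ.<-≤-trans (ℕₚ.≤-<-trans k≤B B<)
             (ℕₚ.≤-trans (nth≤sumV l₁ i) (ℕₚ.m≤m+n (sumV l₁) _))))) ⟩
    ∑∑ (λ l₁ l₂ → w⁺ a b k (bump a l₁) (bump b l₂))
      ≡⟨ ∑∑-cong (λ l₁ l₂ → w⁺-bump k l₁ l₂ a≤n b≤n b≤ a≤) ⟩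
    ∑∑ (λ l₁ l₂ → sh (a ℕ.+ b) (λ k′ → w a b k′ l₁ l₂) k)
      ≡⟨ ∑-cong vs (λ l₁ → sh-∑ (a ℕ.+ b) vs (λ l₂ k′ → w a b k′ l₁ l₂) k) ⟨
    ∑ vs (λ l₁ → sh (a ℕ.+ b) (λ k′ → ∑ vs (w a b k′ l₁)) k)
      ≡⟨ sh-∑ (a ℕ.+ b) vs (λ l₁ k′ → ∑ vs (w a b k′ l₁)) k ⟨
    sh (a ℕ.+ b) (F a b) k ∎
    where open ≡-Reasoning

  F-rec : ∀ {a b k} → suc a ≤ n → suc b ≤ n → suc b ≤ 2 ℕ.+ a → suc a ≤ 4 ℕ.+ b → k ≤ B →
    F (suc a) (suc b) k ≡ F a (suc b) k + F (suc a) b k - F a b k + sh (suc a ℕ.+ suc b) (F (suc a) (suc b)) k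
  F-rec {a} {b} {k} a≤n b≤n b≤ a≤ k≤B = begin
    F (suc a) (suc b) k
      ≡⟨ ∑∑-cong (w-rec a b k) ⟩
    ∑∑ (λ l₁ l₂ → w a (suc b) k l₁ l₂ + w (suc a) b k l₁ l₂ - w a b k l₁ l₂ + w⁺ (suc a) (suc b) k l₁ l₂)
      ≡⟨ ∑∑-+ (λ l₁ l₂ → w a (suc b) k l₁ l₂ + w (suc a) b k l₁ l₂ - w a b k l₁ l₂) (w⁺ (suc a) (suc b) k) ⟩
    ∑∑ (λ l₁ l₂ → w a (suc b) k l₁ l₂ + w (suc a) b k l₁ l₂ - w a b k l₁ l₂) + ∑∑ (w⁺ (suc a) (suc b) k)
      ≡⟨ cong₂ _+_ (∑∑-+ (λ l₁ l₂ → w a (suc b) k l₁ l₂ + w (suc a) b k l₁ l₂) (λ l₁ l₂ → - w a b k l₁ l₂))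
                   (∑∑-w⁺ a≤n b≤n b≤ a≤ k≤B) ⟩
    ∑∑ (λ l₁ l₂ → w a (suc b) k l₁ l₂ + w (suc a) b k l₁ l₂) + ∑∑ (λ l₁ l₂ → - w a b k l₁ l₂) + s
      ≡⟨ cong (_+ s) (cong₂ _+_ (∑∑-+ (w a (suc b) k) (w (suc a) b k)) (∑∑-neg (w a b k))) ⟩
    F a (suc b) k + F (suc a) b k - F a b k + s ∎
    where
    open ≡-Reasoning
    s = sh (suc a ℕ.+ suc b) (F (suc a) (suc b)) k

  F-recˡ : ∀ {a k} → suc a ≤ n → suc a ≤ 3 → k ≤ B → F (suc a) 0 k ≡ F a 0 k + sh (suc a ℕ.+ 0) (F (suc a) 0) k
  F-recˡ {a} {k} a≤n a≤ k≤B = trans (∑∑-cong (w-recˡ a k)) (trans (∑∑-+ (w a 0 k) (w⁺ (suc a) 0 k))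
    (cong (_+_ (F a 0 k)) (∑∑-w⁺ a≤n z≤n z≤n a≤ k≤B)))

  F-recʳ : ∀ {b k} → suc b ≤ n → suc b ≤ 1 → k ≤ B → F 0 (suc b) k ≡ F 0 b k + sh (suc b) (F 0 (suc b)) k
  F-recʳ {b} {k} b≤n b≤ k≤B = trans (∑∑-cong (w-recʳ b k)) (trans (∑∑-+ (w 0 b k) (w⁺ 0 (suc b) k))
    (cong (_+_ (F 0 b k)) (∑∑-w⁺ z≤n b≤n b≤ z≤n k≤B)))

  F-boundary₁ : ∀ m k → F m (2 ℕ.+ m) k ≡ F m (1 ℕ.+ m) k
  F-boundary₁ m k = ∑∑-cong (w-boundary₁ m k)

  F-boundary₂ : ∀ m k → F (4 ℕ.+ m) m k ≡ F (3 ℕ.+ m) m k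
  F-boundary₂ m k = ∑∑-cong (w-boundary₂ m k)

  F-origin : ∀ k → F 0 0 k ≡ oneS k
  F-origin k = begin
    F 0 0 k
      ≡⟨ ∑-cong vs (λ l₁ → ∑-vecs-replicate n B (w 0 0 k l₁) (λ l₂ i → zero₂ l₁ l₂ {i})) ⟩
    ∑ vs (λ l₁ → w 0 0 k l₁ (replicate n 0))
      ≡⟨ ∑-vecs-replicate n B (λ l₁ → w 0 0 k l₁ (replicate n 0)) (λ l₁ i → zero₁ l₁ (replicate n 0) {i}) ⟩
    w 0 0 k (replicate n 0) (replicate n 0)
      ≡⟨ value ⟩
    oneS k ∎
    where
    open ≡-Reasoning
    z-pos : ∀ (v : Vec ℕ n) → (∀ i → nth v (suc i) ≤ nth v i) → ∀ {i m} → nth v i ≡ suc m → isZero (nth v 0) ≡ 0ℤ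
    z-pos v dec {i} {m} eq with nth v 0 | nth-antitone v dec {0} {i} z≤n
    ... | suc _ | _  = refl
    ... | zero  | le with () ← subst (_≤ 0) eq le

    zero₁ : ∀ l₁ l₂ {i m} → nth l₁ i ≡ suc m → w 0 0 k l₁ l₂ ≡ 0ℤ
    zero₁ l₁ l₂ eq = ι-zero (isCyl31 l₁ l₂) λ t →
      cong (λ y → y · isZero (nth l₂ 0) · sizeIs k l₁ l₂) (z-pos l₁ (dec₁ (isCyl31⇒Cyl l₁ l₂ t)) eq)

    zero₂ : ∀ l₁ l₂ {i m} → nth l₂ i ≡ suc m → w 0 0 k l₁ l₂ ≡ 0ℤ
    zero₂ l₁ l₂ eq = ι-zero (isCyl31 l₁ l₂) λ t →
      trans (cong (λ y → isZero (nth l₁ 0) · y · sizeIs k l₁ l₂) (z-pos l₂ (dec₂ (isCyl31⇒Cyl l₁ l₂ t)) eq))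
            (cong (_· sizeIs k l₁ l₂) (ℤₚ.*-zeroʳ (isZero (nth l₁ 0))))

    nth-replicate : ∀ n i → nth (replicate n 0) i ≡ 0
    nth-replicate zero    i       = refl
    nth-replicate (suc n) zero    = refl
    nth-replicate (suc n) (suc i) = nth-replicate n i

    sumV-replicate : ∀ n → sumV (replicate n 0) ≡ 0
    sumV-replicate zero    = refl
    sumV-replicate (suc n) = sumV-replicate n

    cyl : isCyl31 (replicate n 0) (replicate n 0) ≡ true
    cyl = Equivalence.to T-≡ (Cyl⇒isCyl31 (replicate n 0) (replicate n 0) (record
      { dec₁ = λ i → le (suc i) ; dec₂ = λ i → le (suc i) ; inter₁ = λ i → le (suc i) ; inter₂ = λ i → le (3 ℕ.+ i) }))
      where
      le : ∀ j {y} → nth (replicate n 0) j ≤ y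
      le j rewrite nth-replicate n j = z≤n

    value : w 0 0 k (replicate n 0) (replicate n 0) ≡ oneS k
    value rewrite cyl | nth-replicate n 0 | sumV-replicate n = at k
      where
      at : ∀ k → 1ℤ · (1ℤ · 1ℤ · ι (0 ≡ᵇ k)) ≡ oneS k
      at zero    = refl
      at (suc k) = refl

-- With a = b = n the support conditions are vacuous, since `nth` is 0 past the end; the box bound k
-- is that of `cp31Count`.
CP31≡F : ∀ n k → CP31 n k ≡ Count.F n k n n k
CP31≡F n k = begin
  CP31 n k
    ≡⟨ length-filter p (concatMap (λ l₁ → map (l₁ ,,_) vs) vs) ⟩
  ∑ (concatMap (λ l₁ → map (l₁ ,,_) vs) vs) (ι ∘ p)
    ≡⟨ ∑-concatMap (λ l₁ → map (l₁ ,,_) vs) vs (ι ∘ p) ⟩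
  ∑ vs (λ l₁ → ∑ (map (l₁ ,,_) vs) (ι ∘ p))
    ≡⟨ ∑-cong vs (λ l₁ → ∑-map (l₁ ,,_) vs (ι ∘ p)) ⟩
  ∑ vs (λ l₁ → ∑ vs (λ l₂ → ι (isCyl31 l₁ l₂ ∧ (sumV l₁ ℕ.+ sumV l₂ ≡ᵇ k))))
    ≡⟨ ∑-cong vs (λ l₁ → ∑-cong vs (λ l₂ → weight l₁ l₂)) ⟩
  Count.F n k n n k ∎
  where
  open ≡-Reasoning
  vs = vecsUpTo n k
  p : Pair n → Bool
  p (l₁ ,, l₂) = isCyl31 l₁ l₂ ∧ (sumV l₁ ℕ.+ sumV l₂ ≡ᵇ k)
  ι-∧ : ∀ b c → ι (b ∧ c) ≡ ι b · (1ℤ · 1ℤ · ι c)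
  ι-∧ true  true  = refl
  ι-∧ true  false = refl
  ι-∧ false c     = refl
  weight : ∀ l₁ l₂ → ι (isCyl31 l₁ l₂ ∧ (sumV l₁ ℕ.+ sumV l₂ ≡ᵇ k)) ≡ w n n k l₁ l₂
  weight l₁ l₂ rewrite nth-beyond l₁ (ℕₚ.≤-refl {n}) | nth-beyond l₂ (ℕₚ.≤-refl {n}) = ι-∧ (isCyl31 l₁ l₂) _

-- Comparison of F and S

module _ (n B K : ℕ) (B≤K : B ≤ K) where

  open Count n B

  private
    S-bottom : ∀ {a} → a ≤ 3 → ∀ k → S K (+ a) -1ℤ k ≡ 0ℤ
    S-bottom {0} _ k = trans (S-small K 3 2 k) (H-zeroʳ (+ 0) -1ℤ (λ _ → refl) k)
    S-bottom {1} _ k = trans (S-small K 2 2 k) (H-zeroʳ (+ 1) -1ℤ (λ _ → refl) k)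
    S-bottom {2} _ k = trans (S-small K 1 2 k) (H-zeroʳ (+ 2) -1ℤ (λ _ → refl) k)
    S-bottom {3} _ k = trans (S-small K 0 2 k) (H-zeroʳ (+ 3) -1ℤ (λ _ → refl) k)
    S-bottom {suc (suc (suc (suc _)))} (s≤s (s≤s (s≤s ())))

    S-left : ∀ {b} → b ≤ 1 → ∀ k → S K -1ℤ (+ b) k ≡ 0ℤ
    S-left {0} _ k = trans (S-small K 4 1 k) (H-zeroˡ -1ℤ (+ 0) (λ _ → refl) k)
    S-left {1} _ k = trans (S-small K 4 0 k) (H-zeroˡ -1ℤ (+ 1) (λ _ → refl) k)
    S-left {suc (suc _)} (s≤s ())

    only-first : ∀ {a b c d} → b ≡ 0ℤ → c ≡ 0ℤ → a + b - c + d ≡ a + d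
    only-first {a} {d = d} refl refl = eq a d
      where
      eq : ∀ a d → a + 0ℤ - 0ℤ + d ≡ a + d
      eq = solve-∀

    only-second : ∀ {a b c d} → a ≡ 0ℤ → c ≡ 0ℤ → a + b - c + d ≡ b + d
    only-second {b = b} {d = d} refl refl = eq b d
      where
      eq : ∀ b d → 0ℤ + b - 0ℤ + d ≡ b + d
      eq = solve-∀

  -- Induction on a+b inside the strip. Each right-hand side of the recurrence involves only smaller
  -- sums of indices, and `fixpoint-unique` handles the occurrence of the unknown series itself.
  F≡S : ∀ N a b → a ℕ.+ b < N → a ≤ n → b ≤ n → b ≤ 1 ℕ.+ a → a ≤ 3 ℕ.+ b →
    ∀ k → k ≤ B → F a b k ≡ S K (+ a) (+ b) k
  F≡S (suc N) zero zero _ _ _ _ _ k _ =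
    trans (F-origin k) (sym (trans (S-small K 3 1 k) (⊛-oneʳ oneS k)))
  F≡S (suc N) zero (suc b) (s≤s lt) a≤n b≤n b≤@(s≤s b≤0) a≤ =
    fixpoint-unique b {R = F 0 b} {R′ = S K 0ℤ (+ b)} B
      (λ k → F-recʳ b≤n b≤)
      -- `F` has no entry with first index -1; the corresponding values of `S` vanish, so the two
      -- recurrences match.
      (λ k _ → trans (S-rec K 0ℤ (+ suc b) k) (only-second (S-left b≤ k) (S-left (ℕₚ.≤-trans b≤0 z≤n) k)))
      (F≡S N 0 b lt z≤n (ℕₚ.<⇒≤ b≤n) (ℕₚ.≤-trans b≤0 z≤n) z≤n)
  F≡S (suc N) (suc a) zero (s≤s lt) a≤n b≤n b≤ a≤ =
    fixpoint-unique (a ℕ.+ 0) {R = F a 0} {R′ = S K (+ a) 0ℤ} B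
      (λ k → F-recˡ a≤n a≤)
      (λ k _ → trans (S-rec K (+ suc a) 0ℤ k) (only-first {S K (+ a) 0ℤ k} (S-bottom a≤ k) (S-bottom (ℕₚ.<⇒≤ a≤) k)))
      (F≡S N a 0 lt (ℕₚ.<⇒≤ a≤n) z≤n z≤n (ℕₚ.<⇒≤ a≤))
  F≡S (suc N) (suc a) (suc b) (s≤s lt) a≤n b≤n b≤ a≤ =
    fixpoint-unique (a ℕ.+ suc b)
      {R = λ k → F a (suc b) k + F (suc a) b k - F a b k}
      {R′ = λ k → S K (+ a) (+ suc b) k + S K (+ suc a) (+ b) k - S K (+ a) (+ b) k} B
      (λ k → F-rec a≤n b≤n b≤ a≤)
      (λ k _ → S-rec K (+ suc a) (+ suc b) k)
      (λ k k≤B → cong₂ _-_ (cong₂ _+_ (left k k≤B) (down k k≤B))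
        (F≡S N a b (ℕₚ.<-trans (ℕₚ.+-monoʳ-< a (ℕₚ.n<1+n b)) lt) (ℕₚ.<⇒≤ a≤n) (ℕₚ.<⇒≤ b≤n)
          (ℕ.s≤s⁻¹ b≤) (ℕ.s≤s⁻¹ a≤) k k≤B))
    where
    left : ∀ k → k ≤ B → F a (suc b) k ≡ S K (+ a) (+ suc b) k
    left k k≤B with ℕₚ.m≤n⇒m<n∨m≡n b≤
    ... | inj₁ (s≤s b<) = F≡S N a (suc b) lt (ℕₚ.<⇒≤ a≤n) b≤n b< (ℕₚ.<⇒≤ a≤) k k≤B
    -- The neighbour (a, a+2) lies just outside the strip; both boundary relations replace it by (a,
    -- a+1).
    ... | inj₂ refl = trans (F-boundary₁ a k) (trans
      (F≡S N a (suc a) (ℕₚ.<-trans (ℕₚ.+-monoʳ-< a (ℕₚ.n<1+n (suc a))) lt) (ℕₚ.<⇒≤ a≤n) a≤n ℕₚ.≤-refl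
        (ℕₚ.m≤n+m a 4) k k≤B)
      (S-boundary₁ K (+ a) (+ suc (suc a)) k (cong +_ (ℕₚ.+-comm 2 a)) (ℕₚ.≤-trans k≤B B≤K)))

    down : ∀ k → k ≤ B → F (suc a) b k ≡ S K (+ suc a) (+ b) k
    down k k≤B with ℕₚ.m≤n⇒m<n∨m≡n a≤
    ... | inj₁ (s≤s a<) = F≡S N (suc a) b (subst (_< N) (ℕₚ.+-suc a b) lt) a≤n (ℕₚ.<⇒≤ b≤n) (ℕₚ.<⇒≤ b≤) a< k k≤B
    ... | inj₂ refl = trans (F-boundary₂ b k) (trans
      (F≡S N (3 ℕ.+ b) b (ℕₚ.<-trans (ℕₚ.+-monoʳ-< (3 ℕ.+ b) (ℕₚ.n<1+n b)) lt) (ℕₚ.<⇒≤ a≤n) (ℕₚ.<⇒≤ b≤n)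
        (ℕₚ.m≤n+m b 4) ℕₚ.≤-refl k k≤B)
      (S-boundary₂ K (+ (4 ℕ.+ b)) (+ b) k (cong +_ (ℕₚ.+-comm 4 b)) (ℕₚ.≤-trans k≤B B≤K)))

CP31≡S : ∀ n K k → k ≤ K → CP31 n k ≡ S K (+ n) (+ n) k
CP31≡S n K k k≤K = trans (CP31≡F n k)
  (F≡S n k K k≤K (suc (n ℕ.+ n)) n n ℕₚ.≤-refl ℕₚ.≤-refl ℕₚ.≤-refl (ℕₚ.m≤n+m n 1) (ℕₚ.m≤n+m n 3) k ℕₚ.≤-refl)

-- From products of inverse q-factorials to Gaussian binomials

>⇒≤ᵇ-false : ∀ {m b} → m < b → (b ≤ᵇ m) ≡ false
>⇒≤ᵇ-false {m} {b} m<b with b ≤ᵇ m in b≤ᵇm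
... | false = refl
... | true  = ⊥-elim (ℕₚ.<⇒≱ m<b (ℕₚ.≤ᵇ⇒≤ b m (Equivalence.from T-≡ b≤ᵇm)))

-- The binomial is 0 for β < 0 and for β > m; there one index of `H` is negative, so the two zero
-- conventions agree.
gaussℤ≗qPoch⊛H : ∀ m β → gaussℤ m β ≗ qPoch m ⊛ H β (+ m - β)
gaussℤ≗qPoch⊛H m -[1+ b ] x = sym (⊛-zeroʳ (qPoch m) (H-zeroˡ -[1+ b ] (+ m - -[1+ b ]) (λ _ → refl)) x)
gaussℤ≗qPoch⊛H m (+ b) x with ℕₚ.<-≤-connex m b
... | inj₂ b≤m rewrite Equivalence.to T-≡ (ℕₚ.≤⇒≤ᵇ b≤m) | trans (ℤₚ.m-n≡m⊖n m b) (ℤₚ.⊖-≥ b≤m) =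
  ⊛-assoc (qPoch m) (qPochInv b) (qPochInv (m ∸ b)) x
... | inj₁ m<b with ℕₚ.m≤n⇒∃[o]m+o≡n m<b
... | o , refl rewrite >⇒≤ᵇ-false m<b =
  sym (⊛-zeroʳ (qPoch m) (H-zeroʳ (+ (suc m ℕ.+ o)) (+ m - + (suc m ℕ.+ o)) (qPochInvℤ-neg o (eq (+ m) (+ o)))) x)
  where
  eq : ∀ m o → m - (1ℤ + m + o) ≡ -1ℤ - o
  eq = solve-∀

rhsTerm≡sh : ∀ n r k → rhsTerm n r k ≡
  -1ℤ ℤ.^ abs r · sh (expo r) (gaussℤ (2 * n) (+ n - + 3 · r - + (abs r ℕ.% 2))) k
rhsTerm≡sh n r k = trans (if-· (expo r ≤ᵇ k) (-1ℤ ℤ.^ abs r) _) (cong (-1ℤ ℤ.^ abs r ·_) (sym (sh-≡-if (expo r) _ k)))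
  where
  if-· : ∀ c s y → (if c then s · y else 0ℤ) ≡ s · (if c then y else 0ℤ)
  if-· true  s y = refl
  if-· false s y = sym (ℤₚ.*-zeroʳ s)

-1^2* : ∀ h → -1ℤ ℤ.^ (2 * h) ≡ 1ℤ
-1^2* zero    = refl
-1^2* (suc h) rewrite ℕₚ.+-suc h (h ℕ.+ 0) | -1^2* h = refl

2*%2 : ∀ h → (2 * h) ℕ.% 2 ≡ 0
2*%2 h = trans (cong (ℕ._% 2) (ℕₚ.*-comm 2 h)) (ℕ/.m*n%n≡0 h 2)

abs-even : ∀ s → abs (- (+ 2 · s)) ≡ 2 * abs s
abs-even s = trans (ℤₚ.∣-i∣≡∣i∣ (+ 2 · s)) (ℤₚ.abs-* (+ 2) s)

abs-odd : ∀ s → ∃ λ h → abs (+ 2 · s + 1ℤ) ≡ 1 ℕ.+ h * 2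
abs-odd (+ m)    = m , trans (cong abs (cong (_+ 1ℤ) (sym (ℤₚ.pos-* 2 m)))) (trans (ℕₚ.+-comm (2 * m) 1) (cong suc (ℕₚ.*-comm 2 m)))
abs-odd -[1+ m ] rewrite ℕₚ.+-suc m (m ℕ.+ 0) = m , cong suc (ℕₚ.*-comm 2 m)

⊛-·ʳ : ∀ c f g → f ⊛ (λ x → c · g x) ≗ λ x → c · (f ⊛ g) x
⊛-·ʳ c f g k = trans (⊛-comm f (λ x → c · g x) k) (trans (⊛-·ˡ c g f k) (cong (c ·_) (⊛-comm g f k)))

-- The parity correction of the lower index originates here: n + offset is n-3r for even r, while n
-- - offset is n-3r-1 for odd r.
qPoch⊛W : ∀ n t k → (qPoch (2 * n) ⊛ (λ x → sgn t · W (+ n) (+ n) t x)) k ≡ rhsTerm n (root t) k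
qPoch⊛W n t k = begin
  (q ⊛ (λ x → sgn t · W (+ n) (+ n) t x)) k
    ≡⟨ ⊛-·ʳ (sgn t) q (W (+ n) (+ n) t) k ⟩
  sgn t · (q ⊛ sh e (H (+ n - offset t) (+ n + offset t))) k
    ≡⟨ cong (sgn t ·_) (sh-⊛ e q (H (+ n - offset t) (+ n + offset t)) k) ⟩
  sgn t · sh e (q ⊛ H (+ n - offset t) (+ n + offset t)) k
    ≡⟨ cong₂ _·_ (sign t) (sh-cong e (binomial t) k) ⟩
  -1ℤ ℤ.^ abs r · sh e (gaussℤ (2 * n) (β r)) k
    ≡⟨ rhsTerm≡sh n r k ⟨
  rhsTerm n r k ∎
  where
  open ≡-Reasoning
  q = qPoch (2 * n)
  r = root t
  e = expo r

  β : ℤ → ℤ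
  β r = + n - + 3 · r - + (abs r ℕ.% 2)

  sign : ∀ t → sgn t ≡ -1ℤ ℤ.^ abs (root t)
  sign (even s) = sym (trans (cong (-1ℤ ℤ.^_) (abs-even s)) (-1^2* (abs s)))
  sign (odd s) with abs-odd s
  ... | h , eq = sym (trans (cong (-1ℤ ℤ.^_) eq) (cong (-1ℤ ·_) (trans (cong (-1ℤ ℤ.^_) (ℕₚ.*-comm h 2)) (-1^2* h))))

  2n : + (2 * n) ≡ + 2 · + n
  2n = ℤₚ.pos-* 2 n

  β-even : ∀ s → β (root (even s)) ≡ + n + + 6 · s
  β-even s = trans (cong (λ m → + n - + 3 · root (even s) - + m) (trans (cong (ℕ._% 2) (abs-even s)) (2*%2 (abs s)))) (eq (+ n) s)
    where
    eq : ∀ n s → n - + 3 · (- (+ 2 · s)) - 0ℤ ≡ n + + 6 · s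
    eq = solve-∀

  β-odd : ∀ s → β (root (odd s)) ≡ + n - (+ 6 · s + + 4)
  β-odd s with abs-odd s
  ... | h , h-eq = trans (cong (λ m → + n - + 3 · root (odd s) - + m) (trans (cong (ℕ._% 2) h-eq) (ℕ/.[m+kn]%n≡m%n 1 h 2))) (eq (+ n) s)
    where
    eq : ∀ n s → n - + 3 · (+ 2 · s + 1ℤ) - 1ℤ ≡ n - (+ 6 · s + + 4)
    eq = solve-∀

  -- At a = b = n the product H is symmetric, which absorbs the sign of the offset for even r.
  binomial : ∀ t → q ⊛ H (+ n - offset t) (+ n + offset t) ≗ gaussℤ (2 * n) (β (root t))
  binomial (even s) x = begin
    (q ⊛ H (+ n - + 6 · s) (+ n + + 6 · s)) x
      ≡⟨ ⊛-cong {f = q} (λ _ → refl) (H-comm (+ n - + 6 · s) (+ n + + 6 · s)) x ⟩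
    (q ⊛ H (+ n + + 6 · s) (+ n - + 6 · s)) x
      ≡⟨ cong (λ j → (q ⊛ H (+ n + + 6 · s) j) x) (trans (eq (+ n) s) (cong (_- (+ n + + 6 · s)) (sym 2n))) ⟩
    (q ⊛ H (+ n + + 6 · s) (+ (2 * n) - (+ n + + 6 · s))) x
      ≡⟨ gaussℤ≗qPoch⊛H (2 * n) (+ n + + 6 · s) x ⟨
    gaussℤ (2 * n) (+ n + + 6 · s) x
      ≡⟨ cong (λ i → gaussℤ (2 * n) i x) (β-even s) ⟨
    gaussℤ (2 * n) (β (root (even s))) x ∎
    where
    eq : ∀ n s → n - + 6 · s ≡ + 2 · n - (n + + 6 · s)
    eq = solve-∀
  binomial (odd s) x = begin
    (q ⊛ H (+ n - c) (+ n + c)) x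
      ≡⟨ cong (λ j → (q ⊛ H (+ n - c) j) x) (trans (eq (+ n) c) (cong (_- (+ n - c)) (sym 2n))) ⟩
    (q ⊛ H (+ n - c) (+ (2 * n) - (+ n - c))) x
      ≡⟨ gaussℤ≗qPoch⊛H (2 * n) (+ n - c) x ⟨
    gaussℤ (2 * n) (+ n - c) x
      ≡⟨ cong (λ i → gaussℤ (2 * n) i x) (β-odd s) ⟨
    gaussℤ (2 * n) (β (root (odd s))) x ∎
    where
    c = + 6 · s + + 4
    eq : ∀ n c → n + c ≡ + 2 · n - (n - c)
    eq = solve-∀

-- Rearranging the bilateral sum

symSum : (ℤ → ℤ) → ℕ → ℤ
symSum f zero    = f 0ℤ
symSum f (suc N) = symSum f N + (f (+ suc N) + f -[1+ N ])

∑-symRange : ∀ f N → ∑ (symRange N) f ≡ symSum f N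
∑-symRange f N = trans (∑-map (λ i → + i - + N) (upTo (suc (2 * N))) f) (go N)
  where
  go : ∀ N → ∑ (upTo (suc (2 * N))) (λ i → f (+ i - + N)) ≡ symSum f N
  go zero    = ℤₚ.+-identityʳ (f 0ℤ)
  go (suc N) = begin
    ∑ (upTo (suc (2 * suc N))) g
      ≡⟨ cong (λ M → ∑ (upTo (suc (suc M))) g) (ℕₚ.+-suc N (N ℕ.+ 0)) ⟩
    ∑ (upTo (suc (suc (suc (2 * N))))) g
      ≡⟨ ∑-upTo-suc (suc (suc (2 * N))) g ⟩
    g 0 + ∑ (upTo (suc (suc (2 * N)))) (g ∘ suc)
      ≡⟨ cong (_+_ (g 0)) (∑-upTo-last (suc (2 * N)) (g ∘ suc)) ⟩
    g 0 + (∑ (upTo (suc (2 * N))) (g ∘ suc) + g (suc (suc (2 * N))))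
      ≡⟨ cong₂ (λ y u → g 0 + (y + u)) (trans (∑-cong (upTo (suc (2 * N))) (λ i → cong f (shift (+ i) (+ N)))) (go N))
               (cong f (trans (cong (λ y → + 2 + y - + suc N) (ℤₚ.pos-* 2 N)) (top (+ N)))) ⟩
    f -[1+ N ] + (symSum f N + f (+ suc N))
      ≡⟨ regroup (f -[1+ N ]) (symSum f N) (f (+ suc N)) ⟩
    symSum f (suc N) ∎
    where
    open ≡-Reasoning
    g : ℕ → ℤ
    g i = f (+ i - + suc N)
    shift : ∀ i N → 1ℤ + i - (1ℤ + N) ≡ i - N
    shift = solve-∀
    top : ∀ N → + 2 + + 2 · N - (1ℤ + N) ≡ 1ℤ + N
    top = solve-∀
    regroup : ∀ a b c → a + (b + c) ≡ b + (c + a)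
    regroup = solve-∀

symSum-extend : ∀ f N → (∀ r → N < abs r → f r ≡ 0ℤ) → ∀ d → symSum f (N ℕ.+ d) ≡ symSum f N
symSum-extend f N zeros zero rewrite ℕₚ.+-identityʳ N = refl
symSum-extend f N zeros (suc d) rewrite ℕₚ.+-suc N d
  | zeros (+ suc (N ℕ.+ d)) (s≤s (ℕₚ.m≤m+n N d)) | zeros -[1+ N ℕ.+ d ] (s≤s (ℕₚ.m≤m+n N d)) =
  trans (ℤₚ.+-identityʳ _) (symSum-extend f N zeros d)

-- One step in K adds the two layers |r| = 2K+2 (the new even terms) and |r| = 2K+3 (the new odd
-- ones).
symSum-terms : ∀ f K → symSum f (suc (2 * K)) ≡ ∑ (terms K) (f ∘ root)
symSum-terms f zero = cong (_+_ (f 0ℤ)) (cong (_+_ (f 1ℤ)) (sym (ℤₚ.+-identityʳ (f -1ℤ))))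
symSum-terms f (suc K) = begin
  symSum f (suc (2 * suc K))
    ≡⟨ cong (λ M → symSum f (suc (suc M))) (ℕₚ.+-suc K (K ℕ.+ 0)) ⟩
  symSum f (suc (2 * K)) + (f (+ suc (suc M)) + f -[1+ suc M ]) + (f (+ suc (suc (suc M))) + f -[1+ suc (suc M) ])
    ≡⟨ regroup _ (f (+ suc (suc M))) (f -[1+ suc M ]) (f (+ suc (suc (suc M)))) (f -[1+ suc (suc M) ]) ⟩
  f -[1+ suc M ] + (f (+ suc (suc M)) + (f (+ suc (suc (suc M))) + (f -[1+ suc (suc M) ] + symSum f (suc (2 * K)))))
    ≡⟨ cong₂ _+_ (cong f r₁) (cong₂ _+_ (cong f r₂) (cong₂ _+_ (cong f r₃) (cong₂ _+_ (cong f r₄) (symSum-terms f K)))) ⟩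
  ∑ (terms (suc K)) (f ∘ root) ∎
  where
  open ≡-Reasoning
  M = 2 * K
  regroup : ∀ s a b c d → s + (a + b) + (c + d) ≡ b + (a + (c + (d + s)))
  regroup = solve-∀
  r₁ : -[1+ suc M ] ≡ root (even (+ suc K))
  r₁ rewrite ℕₚ.+-suc K (K ℕ.+ 0) = refl
  r₂ : + suc (suc M) ≡ root (even -[1+ K ])
  r₂ rewrite ℕₚ.+-suc K (K ℕ.+ 0) = refl
  r₃ : + suc (suc (suc M)) ≡ root (odd (+ suc K))
  r₃ rewrite ℕₚ.+-suc K (K ℕ.+ 0) | ℕₚ.+-comm (K ℕ.+ (K ℕ.+ 0)) 1 = refl
  r₄ : -[1+ suc (suc M) ] ≡ root (odd -[1+ suc K ])
  r₄ rewrite ℕₚ.+-suc K (suc (K ℕ.+ 0)) | ℕₚ.+-suc K (K ℕ.+ 0) = refl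

theorem5p5 : (n k : ℕ) → (qPoch (2 * n) ⊛ CP31 n) k ≡ RHS n k
theorem5p5 n k = begin
  (qPoch (2 * n) ⊛ CP31 n) k
    -- Only coefficients up to k of the right factor enter, so the truncation K = k is enough.
    ≡⟨ ⊛-cong-≤ (qPoch (2 * n)) k (CP31≡S n k) ⟩
  (qPoch (2 * n) ⊛ S k (+ n) (+ n)) k
    ≡⟨ ⊛-∑ (qPoch (2 * n)) (terms k) (λ t x → sgn t · W (+ n) (+ n) t x) k ⟩
  ∑ (terms k) (λ t → (qPoch (2 * n) ⊛ (λ x → sgn t · W (+ n) (+ n) t x)) k)
    ≡⟨ ∑-cong (terms k) (λ t → qPoch⊛W n t k) ⟩
  ∑ (terms k) (λ t → rhsTerm n (root t) k)
    ≡⟨ symSum-terms (λ r → rhsTerm n r k) k ⟨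
  symSum (λ r → rhsTerm n r k) (suc (2 * k))
    ≡⟨ cong (symSum (λ r → rhsTerm n r k)) (trans (cong (λ m → suc (k ℕ.+ m)) (ℕₚ.+-identityʳ k)) (sym (ℕₚ.+-suc k k))) ⟩
  symSum (λ r → rhsTerm n r k) (k ℕ.+ suc k)
    -- The terms with k < |r| ≤ 2k+1 start beyond degree k.
    ≡⟨ symSum-extend (λ r → rhsTerm n r k) k vanish (suc k) ⟩
  symSum (λ r → rhsTerm n r k) k
    ≡⟨ ∑-symRange (λ r → rhsTerm n r k) k ⟨
  RHS n k ∎
  where
  open ≡-Reasoning
  vanish : ∀ r → k < abs r → rhsTerm n r k ≡ 0ℤ
  vanish r k<r = trans (rhsTerm≡sh n r k)
    (trans (cong (-1ℤ ℤ.^ abs r ·_) (sh-< _ (ℕₚ.<-≤-trans k<r (abs≤expo r)))) (ℤₚ.*-zeroʳ (-1ℤ ℤ.^ abs r)))
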